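{- There exist absolute constants $K_1, K_2, K_3 > 0$ such that the following holds. Let $A \subset \mathbb{C}$ be a set of $N$ complex numbers and let $C$ be a real number with $C \geq K_1$ and $\sqrt{N} \geq K_2 C$, where $K_1, K_2$ are sufficiently large (in particular $K_1, K_2 > 1$). Define $$T_C = \left\{ t \in \mathbb{C} \,:\, |A + tA| \leq \frac{N^{1.5}}{C \sqrt{\log N}} \right\}.$$ Then $$|T_C| \leq K_3 \cdot \frac{N}{C^2}.$$
   Context: For $A \subset \mathbb{C}$ and $t \in \mathbb{C}$, $A + tA = \{a + t a' : a, a' \in A\}$. -}

module Defs where

open import Axiom.ExcludedMiddle using (ExcludedMiddle)
open import Data.Fin using (Fin)
open import Data.Integer using (1ℤ; +_)
open import Data.Nat as ℕ using (ℕ; zero; suc; _!)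
import Data.Nat.Properties as ℕₚ
open ℕₚ using (_!≢0)
open import Data.Product using (_×_; _,_; ∃; ∃-syntax)
open import Data.Rational as ℚ using (ℚ; 0ℚ; 1ℚ; ½; ∣_∣)
import Data.Rational.Properties as ℚₚ
import Data.Rational.Solver as ℚSolver
open import Function.Definitions using (Injective)
open import Level using (0ℓ)
open import Relation.Binary.PropositionalEquality
  using (_≡_; refl; sym; cong; subst; module ≡-Reasoning)
open import Relation.Nullary using (¬_; yes; no)
open import Relation.Unary using (Pred; _∈_)

-- ℝ is a setoid: equality of reals is _≈_ below, not _≡_.

IsCauchy : (ℕ → ℚ) → Set
IsCauchy f = ∀ ε → 0ℚ ℚ.< ε →
  ∃[ M ] (∀ m n → M ℕ.≤ m → M ℕ.≤ n → ∣ f m ℚ.- f n ∣ ℚ.< ε)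

record ℝ : Set where
  constructor mkℝ
  field
    seq    : ℕ → ℚ
    cauchy : IsCauchy seq

open ℝ public

private
  open ℚSolver.+-*-Solver

  +-interchange : ∀ a b c d → (a ℚ.+ b) ℚ.- (c ℚ.+ d) ≡ (a ℚ.- c) ℚ.+ (b ℚ.- d)
  +-interchange = solve 4 (λ a b c d → (a :+ b) :- (c :+ d) := (a :- c) :+ (b :- d)) refl

  neg-swap : ∀ a b → (ℚ.- a) ℚ.- (ℚ.- b) ≡ b ℚ.- a
  neg-swap = solve 2 (λ a b → (:- a) :- (:- b) := b :- a) refl

  add-sub : ∀ a b → a ≡ (a ℚ.- b) ℚ.+ b
  add-sub = solve 2 (λ a b → a := (a :- b) :+ b) refl

  *-difference : ∀ a b c d →
    a ℚ.* b ℚ.- c ℚ.* d ≡ a ℚ.* (b ℚ.- d) ℚ.+ d ℚ.* (a ℚ.- c)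
  *-difference =
    solve 4 (λ a b c d → a :* b :- c :* d := a :* (b :- d) :+ d :* (a :- c)) refl

  half-pos : ∀ ε → 0ℚ ℚ.< ε → 0ℚ ℚ.< ε ℚ.* ½
  half-pos ε ε>0 = ℚₚ.positive⁻¹ (ε ℚ.* ½) {{ℚₚ.pos*pos⇒pos ε {{ℚ.positive ε>0}} ½}}

  half+half : ∀ ε → ε ℚ.* ½ ℚ.+ ε ℚ.* ½ ≡ ε
  half+half ε = begin
    ε ℚ.* ½ ℚ.+ ε ℚ.* ½  ≡⟨ ℚₚ.*-distribˡ-+ ε ½ ½ ⟨
    ε ℚ.* 1ℚ             ≡⟨ ℚₚ.*-identityʳ ε ⟩
    ε                    ∎
    where open ≡-Reasoning

  abstract
    const-cauchy : ∀ q → IsCauchy (λ _ → q)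
    const-cauchy q ε ε>0 = 0 , λ _ _ _ _ →
      subst (λ r → ∣ r ∣ ℚ.< ε) (sym (ℚₚ.+-inverseʳ q)) ε>0

  abstract
    +-cauchy : ∀ f g → IsCauchy f → IsCauchy g → IsCauchy (λ n → f n ℚ.+ g n)
    +-cauchy f g cf cg ε ε>0
      with cf (ε ℚ.* ½) (half-pos ε ε>0) | cg (ε ℚ.* ½) (half-pos ε ε>0)
    ... | M , hf | M′ , hg = M ℕ.⊔ M′ , λ m n p q → begin-strict
      ∣ (f m ℚ.+ g m) ℚ.- (f n ℚ.+ g n) ∣
        ≡⟨ cong ∣_∣ (+-interchange (f m) (g m) (f n) (g n)) ⟩
      ∣ (f m ℚ.- f n) ℚ.+ (g m ℚ.- g n) ∣
        ≤⟨ ℚₚ.∣p+q∣≤∣p∣+∣q∣ (f m ℚ.- f n) (g m ℚ.- g n) ⟩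
      ∣ f m ℚ.- f n ∣ ℚ.+ ∣ g m ℚ.- g n ∣
        <⟨ ℚₚ.+-mono-< (hf m n (ℕₚ.m⊔n≤o⇒m≤o M M′ p) (ℕₚ.m⊔n≤o⇒m≤o M M′ q))
                       (hg m n (ℕₚ.m⊔n≤o⇒n≤o M M′ p) (ℕₚ.m⊔n≤o⇒n≤o M M′ q)) ⟩
      ε ℚ.* ½ ℚ.+ ε ℚ.* ½
        ≡⟨ half+half ε ⟩
      ε ∎
      where open ℚₚ.≤-Reasoning

  abstract
    neg-cauchy : ∀ f → IsCauchy f → IsCauchy (λ n → ℚ.- f n)
    neg-cauchy f cf ε ε>0 with cf ε ε>0
    ... | M , hf = M , λ m n p q → begin-strict
      ∣ (ℚ.- f m) ℚ.- (ℚ.- f n) ∣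
        ≡⟨ cong ∣_∣ (neg-swap (f m) (f n)) ⟩
      ∣ f n ℚ.- f m ∣
        <⟨ hf n m q p ⟩
      ε ∎
      where open ℚₚ.≤-Reasoning

  eventually-bounded : ∀ {f} → IsCauchy f →
    ∃[ B ] (0ℚ ℚ.< B × ∃[ M ] (∀ n → M ℕ.≤ n → ∣ f n ∣ ℚ.≤ B))
  eventually-bounded {f} cf with cf 1ℚ (ℚₚ.positive⁻¹ 1ℚ)
  ... | M , hf = 1ℚ ℚ.+ ∣ f M ∣
               , ℚₚ.+-mono-<-≤ (ℚₚ.positive⁻¹ 1ℚ) (ℚₚ.0≤∣p∣ (f M))
               , M
               , λ n p → begin
    ∣ f n ∣
      ≡⟨ cong ∣_∣ (add-sub (f n) (f M)) ⟩
    ∣ (f n ℚ.- f M) ℚ.+ f M ∣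
      ≤⟨ ℚₚ.∣p+q∣≤∣p∣+∣q∣ (f n ℚ.- f M) (f M) ⟩
    ∣ f n ℚ.- f M ∣ ℚ.+ ∣ f M ∣
      ≤⟨ ℚₚ.+-monoˡ-≤ ∣ f M ∣ (ℚₚ.<⇒≤ (hf n M p ℕₚ.≤-refl)) ⟩
    1ℚ ℚ.+ ∣ f M ∣ ∎
    where open ℚₚ.≤-Reasoning

  pos-inverse : ∀ S → .{{_ : ℚ.Positive S}} → ∃[ r ] (ℚ.Positive r × S ℚ.* r ≡ 1ℚ)
  pos-inverse S = (ℚ.1/ S) {{nz}} , ℚₚ.1/pos⇒pos S , ℚₚ.*-inverseʳ S {{nz}}
    where nz = ℚₚ.pos⇒nonZero S

  *-pos : ∀ p q → ℚ.Positive p → 0ℚ ℚ.< q → 0ℚ ℚ.< p ℚ.* q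
  *-pos p q p>0 q>0 =
    subst (ℚ._< p ℚ.* q) (ℚₚ.*-zeroʳ p) (ℚₚ.*-monoʳ-<-pos p {{p>0}} q>0)

  *-cancel : ∀ S r ε → S ℚ.* r ≡ 1ℚ → S ℚ.* (r ℚ.* ε) ≡ ε
  *-cancel S r ε Sr≡1 = begin
    S ℚ.* (r ℚ.* ε)  ≡⟨ ℚₚ.*-assoc S r ε ⟨
    S ℚ.* r ℚ.* ε    ≡⟨ cong (ℚ._* ε) Sr≡1 ⟩
    1ℚ ℚ.* ε         ≡⟨ ℚₚ.*-identityˡ ε ⟩
    ε                ∎
    where open ≡-Reasoning

  divide-pos : ∀ ε S → 0ℚ ℚ.< ε → 0ℚ ℚ.< S → ∃[ δ ] (0ℚ ℚ.< δ × S ℚ.* δ ≡ ε)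
  divide-pos ε S ε>0 S>0 with pos-inverse S {{ℚ.positive S>0}}
  ... | r , r>0 , Sr≡1 = r ℚ.* ε , *-pos r ε r>0 ε>0 , *-cancel S r ε Sr≡1

  product-bound : ∀ u v C δ → 0ℚ ℚ.< C →
    ∣ u ∣ ℚ.≤ C → ∣ v ∣ ℚ.< δ → ∣ u ℚ.* v ∣ ℚ.< C ℚ.* δ
  product-bound u v C δ C>0 u≤C v<δ = begin-strict
    ∣ u ℚ.* v ∣
      ≡⟨ ℚₚ.∣p*q∣≡∣p∣*∣q∣ u v ⟩
    ∣ u ∣ ℚ.* ∣ v ∣
      ≤⟨ ℚₚ.*-monoʳ-≤-nonNeg ∣ v ∣ {{ℚ.nonNegative (ℚₚ.0≤∣p∣ v)}} u≤C ⟩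
    C ℚ.* ∣ v ∣
      <⟨ ℚₚ.*-monoʳ-<-pos C {{ℚ.positive C>0}} v<δ ⟩
    C ℚ.* δ ∎
    where open ℚₚ.≤-Reasoning

  product-difference-bound : ∀ a b c d B B′ δ → 0ℚ ℚ.< B → 0ℚ ℚ.< B′ →
    ∣ a ∣ ℚ.≤ B → ∣ d ∣ ℚ.≤ B′ → ∣ b ℚ.- d ∣ ℚ.< δ → ∣ a ℚ.- c ∣ ℚ.< δ →
    ∣ a ℚ.* b ℚ.- c ℚ.* d ∣ ℚ.< (B ℚ.+ B′) ℚ.* δ
  product-difference-bound a b c d B B′ δ B>0 B′>0 a≤B d≤B′ b-d<δ a-c<δ = begin-strict
    ∣ a ℚ.* b ℚ.- c ℚ.* d ∣
      ≡⟨ cong ∣_∣ (*-difference a b c d) ⟩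
    ∣ a ℚ.* (b ℚ.- d) ℚ.+ d ℚ.* (a ℚ.- c) ∣
      ≤⟨ ℚₚ.∣p+q∣≤∣p∣+∣q∣ (a ℚ.* (b ℚ.- d)) (d ℚ.* (a ℚ.- c)) ⟩
    ∣ a ℚ.* (b ℚ.- d) ∣ ℚ.+ ∣ d ℚ.* (a ℚ.- c) ∣
      <⟨ ℚₚ.+-mono-< (product-bound a (b ℚ.- d) B δ B>0 a≤B b-d<δ)
                     (product-bound d (a ℚ.- c) B′ δ B′>0 d≤B′ a-c<δ) ⟩
    B ℚ.* δ ℚ.+ B′ ℚ.* δ
      ≡⟨ ℚₚ.*-distribʳ-+ δ B B′ ⟨
    (B ℚ.+ B′) ℚ.* δ ∎
    where open ℚₚ.≤-Reasoning

  sum-pos : ∀ p q → 0ℚ ℚ.< p → 0ℚ ℚ.< q → 0ℚ ℚ.< p ℚ.+ q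
  sum-pos p q = ℚₚ.+-mono-<

  *-cauchy-step : ∀ (f g : ℕ → ℚ) B B′ ε δ Mb Mb′ Mf Mg →
    0ℚ ℚ.< B → 0ℚ ℚ.< B′ → (B ℚ.+ B′) ℚ.* δ ≡ ε →
    (∀ n → Mb ℕ.≤ n → ∣ f n ∣ ℚ.≤ B) →
    (∀ n → Mb′ ℕ.≤ n → ∣ g n ∣ ℚ.≤ B′) →
    (∀ m n → Mf ℕ.≤ m → Mf ℕ.≤ n → ∣ f m ℚ.- f n ∣ ℚ.< δ) →
    (∀ m n → Mg ℕ.≤ m → Mg ℕ.≤ n → ∣ g m ℚ.- g n ∣ ℚ.< δ) →
    ∃[ M ] (∀ m n → M ℕ.≤ m → M ℕ.≤ n →
      ∣ f m ℚ.* g m ℚ.- f n ℚ.* g n ∣ ℚ.< ε)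
  *-cauchy-step f g B B′ ε δ Mb Mb′ Mf Mg B>0 B′>0 Sδ≡ε hB hB′ hf hg = M , λ m n p q →
    subst (∣ f m ℚ.* g m ℚ.- f n ℚ.* g n ∣ ℚ.<_) Sδ≡ε
      (product-difference-bound (f m) (g m) (f n) (g n) B B′ δ B>0 B′>0
        (hB m (≤-trans Mb≤ p)) (hB′ n (≤-trans Mb′≤ q))
        (hg m n (≤-trans Mg≤ p) (≤-trans Mg≤ q))
        (hf m n (≤-trans Mf≤ p) (≤-trans Mf≤ q)))
    where
    open ℕₚ using (≤-trans; m≤m⊔n; m≤n⊔m)

    M : ℕ
    M = (Mf ℕ.⊔ Mg) ℕ.⊔ (Mb ℕ.⊔ Mb′)

    Mf≤ : Mf ℕ.≤ M
    Mf≤ = ≤-trans (m≤m⊔n Mf Mg) (m≤m⊔n (Mf ℕ.⊔ Mg) (Mb ℕ.⊔ Mb′))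

    Mg≤ : Mg ℕ.≤ M
    Mg≤ = ≤-trans (m≤n⊔m Mf Mg) (m≤m⊔n (Mf ℕ.⊔ Mg) (Mb ℕ.⊔ Mb′))

    Mb≤ : Mb ℕ.≤ M
    Mb≤ = ≤-trans (m≤m⊔n Mb Mb′) (m≤n⊔m (Mf ℕ.⊔ Mg) (Mb ℕ.⊔ Mb′))

    Mb′≤ : Mb′ ℕ.≤ M
    Mb′≤ = ≤-trans (m≤n⊔m Mb Mb′) (m≤n⊔m (Mf ℕ.⊔ Mg) (Mb ℕ.⊔ Mb′))

  abstract
    *-cauchy : ∀ f g → IsCauchy f → IsCauchy g → IsCauchy (λ n → f n ℚ.* g n)
    *-cauchy f g cf cg ε ε>0 =
      let B  , B>0  , Mb  , hB  = eventually-bounded cf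
          B′ , B′>0 , Mb′ , hB′ = eventually-bounded cg
          δ , δ>0 , Sδ≡ε = divide-pos ε (B ℚ.+ B′) ε>0 (sum-pos B B′ B>0 B′>0)
          Mf , hf = cf δ δ>0
          Mg , hg = cg δ δ>0
      in *-cauchy-step f g B B′ ε δ Mb Mb′ Mf Mg B>0 B′>0 Sδ≡ε hB hB′ hf hg

infix  4 _≈_ _<_ _≤_
infixl 6 _+_ _-_
infixl 7 _*_
infixr 8 _^_

fromℚ : ℚ → ℝ
fromℚ q = mkℝ (λ _ → q) (const-cauchy q)

fromℕ : ℕ → ℝ
fromℕ n = fromℚ (+ n ℚ./ 1)

0ℝ 1ℝ : ℝ
0ℝ = fromℚ 0ℚ
1ℝ = fromℚ 1ℚ

_+_ _-_ _*_ : ℝ → ℝ → ℝ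
x + y = mkℝ (λ n → seq x n ℚ.+ seq y n) (+-cauchy (seq x) (seq y) (cauchy x) (cauchy y))
x * y = mkℝ (λ n → seq x n ℚ.* seq y n) (*-cauchy (seq x) (seq y) (cauchy x) (cauchy y))

x - y = x + mkℝ (λ n → ℚ.- seq y n) (neg-cauchy (seq y) (cauchy y))

_≈_ _<_ _≤_ : ℝ → ℝ → Set
x ≈ y = ∀ ε → 0ℚ ℚ.< ε →
  ∃[ M ] (∀ n → M ℕ.≤ n → ∣ seq x n ℚ.- seq y n ∣ ℚ.< ε)
x < y = ∃[ ε ] (0ℚ ℚ.< ε ×
  ∃[ M ] (∀ n → M ℕ.≤ n → seq x n ℚ.+ ε ℚ.≤ seq y n))
x ≤ y = ¬ (y < x)

_^_ : ℝ → ℕ → ℝ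
x ^ zero  = 1ℝ
x ^ suc n = x * x ^ n

_⟶_ : (ℕ → ℝ) → ℝ → Set
u ⟶ l = ∀ (ε : ℝ) → 0ℝ < ε →
  ∃[ M ] (∀ n → M ℕ.≤ n → (l - ε < u n) × (u n < l + ε))

expPartialSum : ℝ → ℕ → ℝ
expPartialSum x zero    = 0ℝ
expPartialSum x (suc n) =
  expPartialSum x n + x ^ n * fromℚ (ℚ._/_ 1ℤ (n !) {{n !≢0}})

-- y = exp x, with exp defined by its power series.
IsExp : ℝ → ℝ → Set
IsExp x y = expPartialSum x ⟶ y

record ℂ : Set where
  constructor mkℂ
  field
    re im : ℝ

open ℂ public

infix  4 _≈ᶜ_
infixl 6 _+ᶜ_
infixl 7 _*ᶜ_

_≈ᶜ_ : ℂ → ℂ → Set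
z ≈ᶜ w = (re z ≈ re w) × (im z ≈ im w)

_+ᶜ_ _*ᶜ_ : ℂ → ℂ → ℂ
z +ᶜ w = mkℂ (re z + re w) (im z + im w)
z *ᶜ w = mkℂ (re z * re w - im z * im w) (re z * im w + im z * re w)

-- S has exactly n elements, elements being counted up to _≈ᶜ_.
HasCard : Pred ℂ 0ℓ → ℕ → Set
HasCard S n = ∃[ e ]
  ( Injective {A = Fin n} _≡_ _≈ᶜ_ e
  × (∀ i → e i ∈ S)
  × (∀ z → z ∈ S → ∃[ i ] e i ≈ᶜ z))

CardAtMost : Pred ℂ 0ℓ → ℝ → Set
CardAtMost S b = ∃[ n ] (HasCard S n × fromℕ n ≤ b)

sumDilate : Pred ℂ 0ℓ → ℂ → Pred ℂ 0ℓ
sumDilate A t z = ∃[ a ] ∃[ a′ ] (a ∈ A × a′ ∈ A × z ≈ᶜ a +ᶜ t *ᶜ a′)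

-- Excluded middle makes division, square root and logarithm total functions
-- on ℝ; where the mathematical function is undefined the value is 0ℝ.
module Classical (em : ExcludedMiddle 0ℓ) where

  infix  9 _⁻¹
  infixl 7 _/_

  -- The choice made by em is harmless: every P below is satisfied by at most
  -- one real up to _≈_.
  the : Pred ℝ 0ℓ → ℝ
  the P with em {∃ P}
  ... | yes (x , _) = x
  ... | no  _       = 0ℝ

  _⁻¹ : ℝ → ℝ
  x ⁻¹ = the λ y → x * y ≈ 1ℝ

  _/_ : ℝ → ℝ → ℝ
  x / y = x * y ⁻¹

  √ : ℝ → ℝ
  √ x = the λ y → 0ℝ ≤ y × y * y ≈ x

  log : ℝ → ℝ
  log x = the λ y → IsExp y x

  -- T_C, for a set A of N elements; N^{1.5} is (√N)³.
  T : Pred ℂ 0ℓ → ℕ → ℝ → Pred ℂ 0ℓ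
  T A N C t =
    CardAtMost (sumDilate A t) (√ (fromℕ N) ^ 3 / (C * √ (log (fromℕ N))))

{-# OPTIONS --safe #-}
module Submission where

-- For t ≠ 0 split A × A into the fibres of (a, c) ↦ a + t c. Each fibre projects to
-- similar copies of the same point set in both coordinates, so the nearest neighbour
-- (a′, c′) of (a, c) in its fibre is nearest in both coordinates at once. A point of the
-- plane lies in boundedly many nearest-neighbour discs of one fibre, so if |A + tA| ≤ M
-- the discs contain O(N M) points of A counted with multiplicity, and for a positive
-- proportion of the pairs (a, c) the point a′ is among the O(M / N) points of A closest
-- to a, and c′ among those closest to c. The number of such (a, a′, c, c′) is O(M²), and
-- each determines t because a′ − a = t (c − c′). Hence |T_C| N² = O(M²), and
-- M² C² = O(N³), as log N is bounded below.

-- The counting sees the plane only through a comparison of distances from each centre and a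
-- colouring of directions by `κ` sectors. Octants with a flag for the zero vector give `κ` = 16,
-- hence at most 64 · 16² · M² / N² nonzero dilates, where M is the largest |A + tA|. The bound log
-- N ≥ 1/2 costs a factor 2 and t = 0 adds one element, whence `K` = 1 + 2 · 16384. The choices `K₁`
-- = 2 and `K₂` = 4 give N ≥ 16 C² ≥ 64, enough for 4 M ≤ N², so that one-point fibres take at most
-- a quarter of the pairs. Two features of the statement shape the rest. The cardinality of T must
-- be exhibited, not only bounded, so finite families in T first get a cap that depends on N alone.
-- And `√`, `log` and `_⁻¹` may take the default value 0: neither √N nor log N is constructed. The
-- hypothesis on √N excludes the default of the root, and inside T any default would make the upper
-- bound 0, although A + tA is nonempty. Only the reciprocal of C² in the conclusion is built.

open import Axiom.ExcludedMiddle using (ExcludedMiddle)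
open import Data.Empty using (⊥; ⊥-elim)
open import Data.Fin using (Fin; zero; suc; combine; fromℕ<; inject≤; punchIn)
import Data.Fin.Properties as Finₚ
open import Data.Integer as ℤ using (1ℤ; +_)
import Data.Integer.Properties as ℤₚ
open import Data.Nat as ℕ using (ℕ; zero; suc; _!)
import Data.Nat.DivMod as ℕᵈ
import Data.Nat.Properties as ℕₚ
open ℕₚ using (_!≢0)
open import Data.Nat.Solver using (module +-*-Solver)
open import Data.Product using (_×_; _,_; ∃; ∃-syntax; proj₁; proj₂)
open import Data.Rational as ℚ using (ℚ; 0ℚ; 1ℚ; ½; ∣_∣)
import Data.Rational.Properties as ℚₚ
import Data.Rational.Solver as ℚSolver
open import Data.Rational.Unnormalised as ℚᵘ using (mkℚᵘ; *≤*; *≡*)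
import Data.Rational.Unnormalised.Properties as ℚᵘₚ
open import Data.Sum using (_⊎_; inj₁; inj₂; [_,_]′)
open import Level using (0ℓ)
open import Relation.Binary.PropositionalEquality
  using (_≡_; _≢_; refl; sym; trans; cong; cong₂; subst)
open import Relation.Nullary using (¬_; yes; no)
open import Relation.Unary using (Pred; _∈_)
open import Algebra.Properties.Semiring.Sum ℕₚ.+-*-semiring
  using (∑-comm; ∑-distrib-+; *-distribˡ-sum; *-distribʳ-sum; sum-cong-≗)
  renaming (sum to ∑)
open import Defs

-- Counting with finite sums of indicators

∑-mono : ∀ {n} {f g : Fin n → ℕ} → (∀ i → f i ℕ.≤ g i) → ∑ f ℕ.≤ ∑ g
∑-mono {zero}  f≤g = ℕ.z≤n
∑-mono {suc n} f≤g = ℕₚ.+-mono-≤ (f≤g zero) (∑-mono λ i → f≤g (suc i))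

∑-≤ : ∀ {n c} {f : Fin n → ℕ} → (∀ i → f i ℕ.≤ c) → ∑ f ℕ.≤ n ℕ.* c
∑-≤ {zero}  f≤c = ℕ.z≤n
∑-≤ {suc n} f≤c = ℕₚ.+-mono-≤ (f≤c zero) (∑-≤ λ i → f≤c (suc i))

∑-≥ : ∀ {n c} {f : Fin n → ℕ} → (∀ i → c ℕ.≤ f i) → n ℕ.* c ℕ.≤ ∑ f
∑-≥ {zero}  c≤f = ℕ.z≤n
∑-≥ {suc n} c≤f = ℕₚ.+-mono-≤ (c≤f zero) (∑-≥ λ i → c≤f (suc i))

term≤∑ : ∀ {n} (f : Fin n → ℕ) i → f i ℕ.≤ ∑ f
term≤∑ f zero    = ℕₚ.m≤m+n (f zero) _
term≤∑ f (suc i) = ℕₚ.≤-trans (term≤∑ (λ j → f (suc j)) i) (ℕₚ.m≤n+m _ (f zero))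

∑∑-+ : ∀ {m n} (f g : Fin m → Fin n → ℕ) →
  ∑ (λ i → ∑ (λ j → f i j ℕ.+ g i j)) ≡ ∑ (λ i → ∑ (f i)) ℕ.+ ∑ (λ i → ∑ (g i))
∑∑-+ f g = trans (sum-cong-≗ λ i → ∑-distrib-+ (f i) (g i))
  (∑-distrib-+ (λ i → ∑ (f i)) (λ i → ∑ (g i)))

∑-comm₃ : ∀ {l m n} (f : Fin l → Fin m → Fin n → ℕ) →
  ∑ (λ i → ∑ λ j → ∑ λ k → f i j k) ≡ ∑ (λ k → ∑ λ i → ∑ λ j → f i j k)
∑-comm₃ f = trans (sum-cong-≗ λ i → ∑-comm (f i)) (∑-comm λ i k → ∑ λ j → f i j k)

-- If 4 M exceeded N², then N⁴ < 16 M² = 8 (2 M²) ≤ 8 N³ ≤ N⁴.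
quarter-square : ∀ {M N} → 64 ℕ.≤ N → 2 ℕ.* (M ℕ.* M) ℕ.≤ N ℕ.* (N ℕ.* N) → 4 ℕ.* M ℕ.≤ N ℕ.* N
quarter-square {M} {N} 64≤N h with 4 ℕ.* M ℕₚ.≤? N ℕ.* N
... | yes p = p
... | no ¬p = ⊥-elim (ℕₚ.<-irrefl refl (begin-strict
  (N ℕ.* N) ℕ.* (N ℕ.* N)  <⟨ ℕₚ.*-mono-< (ℕₚ.≰⇒> ¬p) (ℕₚ.≰⇒> ¬p) ⟩
  (4 ℕ.* M) ℕ.* (4 ℕ.* M)  ≡⟨ solve 1 (λ m → (con 4 :* m) :* (con 4 :* m) := con 8 :* (con 2 :* (m :* m))) refl M ⟩
  8 ℕ.* (2 ℕ.* (M ℕ.* M))  ≤⟨ ℕₚ.*-mono-≤ (ℕₚ.≤-trans (ℕₚ.m≤m+n 8 56) 64≤N) h ⟩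
  N ℕ.* (N ℕ.* (N ℕ.* N))  ≡⟨ solve 1 (λ n → n :* (n :* (n :* n)) := (n :* n) :* (n :* n)) refl N ⟩
  (N ℕ.* N) ℕ.* (N ℕ.* N)  ∎))
  where
  open ℕₚ.≤-Reasoning
  open +-*-Solver using (solve; _:=_; _:*_; con)

-- Eliminates `M`, so that one natural number depending on `N` alone caps every finite family in T.
-- The constant comes from 16384 = 1024 · 4².
crude-bound : ∀ {σ M N} → .{{ℕ.NonZero N}} → 4 ℕ.* M ℕ.≤ N ℕ.* N →
  σ ℕ.* (N ℕ.* N) ℕ.≤ 16384 ℕ.* (M ℕ.* M) → σ ℕ.≤ 1024 ℕ.* (N ℕ.* N)
crude-bound {σ} {M} {N} 4M≤N² h = ℕₚ.*-cancelʳ-≤ σ (1024 ℕ.* (N ℕ.* N)) (N ℕ.* N) {{ℕₚ.m*n≢0 N N}} (begin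
  σ ℕ.* (N ℕ.* N)                       ≤⟨ h ⟩
  16384 ℕ.* (M ℕ.* M)                   ≡⟨ ℕₚ.*-assoc 1024 16 (M ℕ.* M) ⟩
  1024 ℕ.* (16 ℕ.* (M ℕ.* M))           ≡⟨ cong (1024 ℕ.*_) (solve 1 (λ m → con 16 :* (m :* m) := (con 4 :* m) :* (con 4 :* m)) refl M) ⟩
  1024 ℕ.* ((4 ℕ.* M) ℕ.* (4 ℕ.* M))    ≤⟨ ℕₚ.*-monoʳ-≤ 1024 (ℕₚ.*-mono-≤ 4M≤N² 4M≤N²) ⟩
  1024 ℕ.* ((N ℕ.* N) ℕ.* (N ℕ.* N))    ≡⟨ ℕₚ.*-assoc 1024 (N ℕ.* N) (N ℕ.* N) ⟨
  1024 ℕ.* (N ℕ.* N) ℕ.* (N ℕ.* N)      ∎)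
  where
  open ℕₚ.≤-Reasoning
  open +-*-Solver using (solve; _:=_; _:*_; con)

-- Indicators, double counting and extremal elements

module Counting (em : ExcludedMiddle 0ℓ) where

  -- Sums of `ι` stand in for cardinalities, so no set of pairs ever has to be enumerated.
  ι : Set → ℕ
  ι P with em {P}
  ... | yes _ = 1
  ... | no _  = 0

  ι≤1 : ∀ P → ι P ℕ.≤ 1
  ι≤1 P with em {P}
  ... | yes _ = ℕₚ.≤-refl
  ... | no _  = ℕ.z≤n

  ι-yes : ∀ {P} → P → 1 ℕ.≤ ι P
  ι-yes {P} p with em {P}
  ... | yes _ = ℕₚ.≤-refl
  ... | no ¬p = ⊥-elim (¬p p)

  ι-≤ : ∀ {P k} → (P → 1 ℕ.≤ k) → ι P ℕ.≤ k
  ι-≤ {P} f with em {P}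
  ... | yes p = f p
  ... | no _  = ℕ.z≤n

  ι-no : ∀ {P} → ¬ P → ι P ℕ.≤ 0
  ι-no ¬p = ι-≤ λ p → ⊥-elim (¬p p)

  ι-mono : ∀ {P Q} → (P → Q) → ι P ℕ.≤ ι Q
  ι-mono f = ι-≤ λ p → ι-yes (f p)

  ι-×-≤ : ∀ {P Q R} → (P → Q × R) → ι P ℕ.≤ ι Q ℕ.* ι R
  ι-×-≤ f = ι-≤ λ p → ℕₚ.*-mono-≤ (ι-yes (proj₁ (f p))) (ι-yes (proj₂ (f p)))

  ι-∃≤∑ : ∀ {n} (P : Fin n → Set) → ι (∃ P) ℕ.≤ ∑ (λ i → ι (P i))
  ι-∃≤∑ P = ι-≤ λ { (i , p) → ℕₚ.≤-trans (ι-yes p) (term≤∑ (λ i → ι (P i)) i) }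

  ∑≤ι-∃ : ∀ {n} (P : Fin n → Set) → (∀ i j → P i → P j → i ≡ j) → ∑ (λ i → ι (P i)) ℕ.≤ ι (∃ P)
  ∑≤ι-∃ {zero}  P unique = ℕ.z≤n
  ∑≤ι-∃ {suc n} P unique with em {P zero}
  ... | yes p = ℕₚ.≤-trans
    (ℕₚ.+-monoʳ-≤ 1 (ℕₚ.≤-trans (∑-≤ {c = 0} λ i → ι-no λ q → Finₚ.0≢1+n (unique zero (suc i) p q))
      (ℕₚ.≤-reflexive (ℕₚ.*-zeroʳ n))))
    (ι-yes (zero , p))
  ... | no _ = ℕₚ.≤-trans
    (∑≤ι-∃ (λ i → P (suc i)) λ i j p q → Finₚ.suc-injective (unique (suc i) (suc j) p q))
    (ι-mono λ { (i , p) → suc i , p })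

  -- Summed by the value `k` of `g`: injectivity leaves at most one pair over each of the `n`
  -- values.
  injection-bound : ∀ {l m n} (P : Fin l → Fin m → Set) (g : Fin l → Fin m → Fin n) →
    (∀ {i j i′ j′} → P i j → P i′ j′ → g i j ≡ g i′ j′ → i ≡ i′ × j ≡ j′) →
    ∑ (λ i → ∑ λ j → ι (P i j)) ℕ.≤ n
  injection-bound {l} {m} {n} P g inj = begin
    ∑ (λ i → ∑ λ j → ι (P i j))        ≤⟨ ∑-mono (λ i → ∑-mono λ j → ℕₚ.≤-trans
                                            (ι-mono λ p → g i j , p , refl)
                                            (ι-∃≤∑ (Q i j))) ⟩
    ∑ (λ i → ∑ λ j → ∑ λ k → ι (Q i j k))  ≡⟨ ∑-comm₃ (λ i j k → ι (Q i j k)) ⟩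
    ∑ (λ k → ∑ λ i → ∑ λ j → ι (Q i j k))  ≤⟨ ∑-≤ fibre ⟩
    n ℕ.* 1                            ≡⟨ ℕₚ.*-identityʳ n ⟩
    n                                  ∎
    where
    open ℕₚ.≤-Reasoning
    Q : Fin l → Fin m → Fin n → Set
    Q i j k = P i j × g i j ≡ k
    same : ∀ {i j i′ j′ k} → Q i j k → Q i′ j′ k → i ≡ i′ × j ≡ j′
    same (p , eq) (p′ , eq′) = inj p p′ (trans eq (sym eq′))
    fibre : ∀ k → ∑ (λ i → ∑ λ j → ι (Q i j k)) ℕ.≤ 1
    fibre k = ℕₚ.≤-trans
      (∑-mono λ i → ∑≤ι-∃ (λ j → Q i j k) λ j j′ p q → proj₂ (same p q))
      (ℕₚ.≤-trans
        (∑≤ι-∃ (λ i → ∃ λ j → Q i j k) λ { i i′ (_ , p) (_ , q) → proj₁ (same p q) })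
        (ι≤1 _))

  -- Serves three times: for the farthest point of small rank, with the order reversed for the
  -- nearest neighbour, and for the largest sumset.
  best : ∀ {n} (_⊑_ : Fin n → Fin n → Set) → (∀ i j → i ⊑ j ⊎ j ⊑ i) →
    (∀ {i j k} → i ⊑ j → j ⊑ k → i ⊑ k) → (P : Fin n → Set) → ∃ P →
    ∃[ b ] (P b × ∀ i → P i → i ⊑ b)
  best {zero} _ _ _ _ (() , _)
  best {suc n} _⊑_ total tr P (i₀ , p₀) with em {∃ λ i → P (suc i)}
  ... | no none = zero , P-zero i₀ p₀ , λ
        { zero _ → reflexive zero ; (suc i) p → ⊥-elim (none (i , p)) }
    where
    reflexive : ∀ i → i ⊑ i
    reflexive i = [ (λ r → r) , (λ r → r) ]′ (total i i)
    P-zero : ∀ i → P i → P zero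
    P-zero zero    p = p
    P-zero (suc i) p = ⊥-elim (none (i , p))
  ... | yes some with best (λ i j → suc i ⊑ suc j) (λ i j → total (suc i) (suc j)) tr (λ i → P (suc i)) some
  ...   | b , pb , max with em {P zero} | total zero (suc b)
  ...     | no ¬p | _ = suc b , pb , λ { zero p → ⊥-elim (¬p p) ; (suc i) p → max i p }
  ...     | yes _ | inj₁ r = suc b , pb , λ { zero _ → r ; (suc i) p → max i p }
  ...     | yes p | inj₂ r = zero , p , λ
            { zero _ → [ (λ r → r) , (λ r → r) ]′ (total zero zero) ; (suc i) q → tr (max i q) r }

-- Near a x y stands for |x − a| ≤ |y − a|, and sector z a for the direction of z − a.
module Discs (em : ExcludedMiddle 0ℓ) {N κ : ℕ}
  (Near : Fin N → Fin N → Fin N → Set)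
  (near-total : ∀ a x y → Near a x y ⊎ Near a y x)
  (near-trans : ∀ a {x y z} → Near a x y → Near a y z → Near a x z)
  (sector : Fin N → Fin N → Fin κ)
  (sector-separates : ∀ {z a b} → sector z a ≡ sector z b → Near a z b → Near b z a → a ≡ b)
  where

  open Counting em

  rank : Fin N → Fin N → ℕ
  rank a b = ∑ λ j → ι (Near a j b)

  -- Let `b` be the farthest from `a` among the points of rank at most `R`. Each of these points is
  -- no farther than `b`, hence counted by `rank a b`. Ties do no harm because `rank` counts a
  -- closed disc.
  rank-count : ∀ R a → ∑ (λ b → ι (rank a b ℕ.≤ R)) ℕ.≤ R
  rank-count R a with em {∃ λ b → rank a b ℕ.≤ R}
  ... | no none = ℕₚ.≤-trans (∑-≤ {c = 0} λ b → ι-no λ r → none (b , r))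
                    (ℕₚ.≤-trans (ℕₚ.≤-reflexive (ℕₚ.*-zeroʳ N)) ℕ.z≤n)
  ... | yes some with best (Near a) (near-total a) (near-trans a) _ some
  ...   | b , r , max = ℕₚ.≤-trans (∑-mono λ j → ι-mono (max j)) r

  -- The closed disc about `a` that reaches to its nearest neighbour in the fibre. Quantifying over
  -- all `a′` avoids naming that neighbour; where there is none, the disc is everything.
  InDisc : ∀ {M} → (Fin N → Fin N → Fin M) → Fin N → Fin N → Fin N → Set
  InDisc fib a c j = ∀ a′ c′ → a′ ≢ a → fib a′ c′ ≡ fib a c → Near a j a′

  -- The nearest-neighbour discs of one fibre cover each point at most κ times.
  packing : ∀ {M} (fib : Fin N → Fin N → Fin M) →
    (∀ {a c c′} → fib a c ≡ fib a c′ → c ≡ c′) →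
    ∀ j → ∑ (λ a → ∑ λ c → ι (InDisc fib a c j)) ℕ.≤ κ ℕ.* M
  packing fib injʳ j = injection-bound _ (λ a c → combine (sector j a) (fib a c)) inj
    where
    inj : ∀ {a c a′ c′} → InDisc fib a c j → InDisc fib a′ c′ j →
      combine (sector j a) (fib a c) ≡ combine (sector j a′) (fib a′ c′) → a ≡ a′ × c ≡ c′
    inj {a} {c} {a′} {c′} d d′ eq with Finₚ.combine-injective (sector j a) (fib a c) (sector j a′) (fib a′ c′) eq
    ... | s , f with a Finₚ.≟ a′
    ...   | yes refl = refl , injʳ f
    -- Each of the two centres is a competitor in the other's disc, so `j` is no farther from either
    -- centre than they are from each other.
    ...   | no a≢a′  = ⊥-elim (a≢a′ (sector-separates s
              (d a′ c′ (λ e → a≢a′ (sym e)) (sym f)) (d′ a c a≢a′ f)))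

  -- By `packing`, summed over `j`, all discs together hold at most `N · κ M` points, and each
  -- overfull disc uses up at least `suc R` of them.
  markov : ∀ {M} (fib : Fin N → Fin N → Fin M) →
    (∀ {a c c′} → fib a c ≡ fib a c′ → c ≡ c′) → ∀ R →
    suc R ℕ.* ∑ (λ a → ∑ λ c → ι (R ℕ.< ∑ λ j → ι (InDisc fib a c j))) ℕ.≤ N ℕ.* (κ ℕ.* M)
  markov {M} fib injʳ R = begin
    suc R ℕ.* ∑ (λ a → ∑ λ c → ι (R ℕ.< S a c))      ≡⟨ *-distribˡ-sum (suc R) (λ a → ∑ λ c → ι (R ℕ.< S a c)) ⟩
    ∑ (λ a → suc R ℕ.* ∑ λ c → ι (R ℕ.< S a c))      ≡⟨ sum-cong-≗ (λ a → *-distribˡ-sum (suc R) (λ c → ι (R ℕ.< S a c))) ⟩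
    ∑ (λ a → ∑ λ c → suc R ℕ.* ι (R ℕ.< S a c))      ≤⟨ ∑-mono (λ a → ∑-mono λ c → term a c) ⟩
    ∑ (λ a → ∑ λ c → S a c)                          ≡⟨ ∑-comm₃ (λ a c j → ι (InDisc fib a c j)) ⟩
    ∑ (λ j → ∑ λ a → ∑ λ c → ι (InDisc fib a c j))   ≤⟨ ∑-≤ (packing fib injʳ) ⟩
    N ℕ.* (κ ℕ.* M)                                  ∎
    where
    open ℕₚ.≤-Reasoning
    S : Fin N → Fin N → ℕ
    S a c = ∑ λ j → ι (InDisc fib a c j)
    term : ∀ a c → suc R ℕ.* ι (R ℕ.< S a c) ℕ.≤ S a c
    term a c with em {R ℕ.< S a c}
    ... | yes r = ℕₚ.≤-trans (ℕₚ.≤-reflexive (ℕₚ.*-identityʳ (suc R))) r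
    ... | no _  = ℕₚ.≤-trans (ℕₚ.≤-reflexive (ℕₚ.*-zeroʳ (suc R))) ℕ.z≤n

  -- All that is kept of the geometry of a + t c = const with t ≠ 0: each fibre is the graph of a
  -- partial injection, and that injection preserves comparisons of distance.
  record Similarity {M} (fib : Fin N → Fin N → Fin M) : Set where
    field
      injʳ : ∀ {a c c′} → fib a c ≡ fib a c′ → c ≡ c′
      injˡ : ∀ {a a′ c} → fib a c ≡ fib a′ c → a ≡ a′
      near : ∀ {a c a′ c′ a″ c″} → fib a′ c′ ≡ fib a c → fib a″ c″ ≡ fib a c →
             Near a a′ a″ → Near c c′ c″

  ClosePair : ∀ {M} → ℕ → (Fin N → Fin N → Fin M) → (a c a′ c′ : Fin N) → Set
  ClosePair R fib a c a′ c′ =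
    a′ ≢ a × fib a′ c′ ≡ fib a c × rank a a′ ℕ.≤ R × rank c c′ ℕ.≤ R

  Good : ∀ {M} → ℕ → (Fin N → Fin N → Fin M) → (a c : Fin N) → Set
  Good R fib a c = ∃[ a′ ] ∃[ c′ ] ClosePair R fib a c a′ c′

  module Fibres {M} (fib : Fin N → Fin N → Fin M) (similarity : Similarity fib) (R : ℕ) where
    open Similarity similarity

    Single Far₁ Far₂ : Fin N → Fin N → Set
    Single a c = ∀ a′ c′ → fib a′ c′ ≡ fib a c → a′ ≡ a
    Far₁ a c = R ℕ.< ∑ λ j → ι (InDisc fib a c j)
    Far₂ a c = R ℕ.< ∑ λ j → ι (InDisc (λ c a → fib a c) c a j)

    -- Let `b` be the nearest neighbour of `a` in the fibre and `d` its partner. If `rank a b`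
    -- exceeds `R`, all the points it counts lie in the disc about `a`; if `rank c d` does, they lie
    -- in the disc about `c`. Otherwise `b` and `d` make the pair good.
    classify : ∀ a c → 1 ℕ.≤ ι (Good R fib a c) ℕ.+ ι (Single a c) ℕ.+ (ι (Far₁ a c) ℕ.+ ι (Far₂ a c))
    classify a c with em {∃ λ a′ → a′ ≢ a × ∃ λ c′ → fib a′ c′ ≡ fib a c}
    ... | no none = ℕₚ.≤-trans (ι-yes single)
          (ℕₚ.≤-trans (ℕₚ.m≤n+m _ (ι (Good R fib a c))) (ℕₚ.m≤m+n _ _))
      where
      single : Single a c
      single a′ c′ eq with a′ Finₚ.≟ a
      ... | yes p = p
      ... | no ¬p = ⊥-elim (none (a′ , ¬p , c′ , eq))
    ... | yes some with best (λ x y → Near a y x) (λ x y → near-total a y x)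
                          (λ p q → near-trans a q p) _ some
    ...   | b , (b≢a , d , eq) , nearest with rank a b ℕₚ.≤? R | rank c d ℕₚ.≤? R
    ...     | yes p | yes q = ℕₚ.≤-trans (ι-yes (b , d , b≢a , eq , p , q))
                (ℕₚ.≤-trans (ℕₚ.m≤m+n _ (ι (Single a c))) (ℕₚ.m≤m+n _ _))
    ...     | no ¬p | _ = ℕₚ.≤-trans (ι-yes far)
                (ℕₚ.≤-trans (ℕₚ.m≤m+n _ (ι (Far₂ a c))) (ℕₚ.m≤n+m _ (ι (Good R fib a c) ℕ.+ ι (Single a c))))
      where
      far : Far₁ a c
      far = ℕₚ.<-≤-trans (ℕₚ.≰⇒> ¬p) (∑-mono λ j → ι-mono (inDisc j))
        where
        inDisc : ∀ j → Near a j b → InDisc fib a c j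
        inDisc j n a′ c′ a′≢a eq′ = near-trans a n (nearest a′ (a′≢a , c′ , eq′))
    ...     | yes _ | no ¬q = ℕₚ.≤-trans (ι-yes far)
                (ℕₚ.≤-trans (ℕₚ.m≤n+m _ (ι (Far₁ a c))) (ℕₚ.m≤n+m _ (ι (Good R fib a c) ℕ.+ ι (Single a c))))
      where
      far : Far₂ a c
      far = ℕₚ.<-≤-trans (ℕₚ.≰⇒> ¬q) (∑-mono λ j → ι-mono (inDisc j))
        where
        inDisc : ∀ j → Near c j d → InDisc (λ c a → fib a c) c a j
        -- Minimality of `b` about `a` passes to minimality of `d` about `c` through `near`; by
        -- `injʳ`, a competitor with `c′ ≢ c` also has `a′ ≢ a`.
        inDisc j n c′ a′ c′≢c eq′ = near-trans c n (near eq eq′ (nearest a′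
          ((λ { refl → c′≢c (injʳ eq′) }) , c′ , eq′)))

    single-count : ∑ (λ a → ∑ λ c → ι (Single a c)) ℕ.≤ M
    single-count = injection-bound _ fib inj
      where
      inj : ∀ {a c a′ c′} → Single a c → Single a′ c′ → fib a c ≡ fib a′ c′ → a ≡ a′ × c ≡ c′
      inj s s′ eq with s′ _ _ eq
      ... | refl = refl , injʳ eq

    -- One-point fibres, overfull discs about `a` and overfull discs about `c` each take at most a
    -- quarter of the N² pairs, which leaves a quarter for the good ones.
    good-count : .{{ℕ.NonZero N}} → 4 ℕ.* M ℕ.≤ N ℕ.* N → 4 ℕ.* (κ ℕ.* M) ℕ.≤ N ℕ.* suc R →
      N ℕ.* N ℕ.≤ 4 ℕ.* ∑ (λ a → ∑ λ c → ι (Good R fib a c))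
    good-count M-small R-large = ℕₚ.+-cancelˡ-≤ (3 ℕ.* (N ℕ.* N)) _ _ (begin
      3 ℕ.* (N ℕ.* N) ℕ.+ N ℕ.* N        ≡⟨ solve 1 (λ n → con 3 :* (n :* n) :+ n :* n := con 4 :* (n :* (n :* con 1))) refl N ⟩
      4 ℕ.* (N ℕ.* (N ℕ.* 1))            ≤⟨ ℕₚ.*-monoʳ-≤ 4 total ⟩
      4 ℕ.* (g ℕ.+ s ℕ.+ (f₁ ℕ.+ f₂))    ≡⟨ solve 4 (λ g s a b → con 4 :* (g :+ s :+ (a :+ b)) :=
                                              (con 4 :* s :+ (con 4 :* a :+ con 4 :* b)) :+ con 4 :* g) refl g s f₁ f₂ ⟩
      (4 ℕ.* s ℕ.+ (4 ℕ.* f₁ ℕ.+ 4 ℕ.* f₂)) ℕ.+ 4 ℕ.* g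
        ≤⟨ ℕₚ.+-monoˡ-≤ (4 ℕ.* g) (ℕₚ.+-mono-≤
             (ℕₚ.≤-trans (ℕₚ.*-monoʳ-≤ 4 single-count) M-small)
             (ℕₚ.+-mono-≤ (few f₁ (markov fib injʳ R))
               (few f₂ (ℕₚ.≤-trans (ℕₚ.≤-reflexive (cong (suc R ℕ.*_) (∑-comm λ a c → ι (Far₂ a c))))
                 (markov (λ c a → fib a c) injˡ R))))) ⟩
      (N ℕ.* N ℕ.+ (N ℕ.* N ℕ.+ N ℕ.* N)) ℕ.+ 4 ℕ.* g
        ≡⟨ cong (ℕ._+ 4 ℕ.* g) (solve 1 (λ n → n :* n :+ (n :* n :+ n :* n) := con 3 :* (n :* n)) refl N) ⟩
      3 ℕ.* (N ℕ.* N) ℕ.+ 4 ℕ.* g        ∎)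
      where
      open ℕₚ.≤-Reasoning
      open +-*-Solver using (solve; _:=_; _:+_; _:*_; con)
      g  = ∑ λ a → ∑ λ c → ι (Good R fib a c)
      s  = ∑ λ a → ∑ λ c → ι (Single a c)
      f₁ = ∑ λ a → ∑ λ c → ι (Far₁ a c)
      f₂ = ∑ λ a → ∑ λ c → ι (Far₂ a c)

      total : N ℕ.* (N ℕ.* 1) ℕ.≤ g ℕ.+ s ℕ.+ (f₁ ℕ.+ f₂)
      total = ℕₚ.≤-trans (∑-≥ λ a → ∑-≥ λ c → classify a c)
        (ℕₚ.≤-reflexive (trans
          (∑∑-+ (λ a c → ι (Good R fib a c) ℕ.+ ι (Single a c)) (λ a c → ι (Far₁ a c) ℕ.+ ι (Far₂ a c)))
          (cong₂ ℕ._+_ (∑∑-+ (λ a c → ι (Good R fib a c)) (λ a c → ι (Single a c)))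
            (∑∑-+ (λ a c → ι (Far₁ a c)) (λ a c → ι (Far₂ a c))))))

      few : ∀ f → suc R ℕ.* f ℕ.≤ N ℕ.* (κ ℕ.* M) → 4 ℕ.* f ℕ.≤ N ℕ.* N
      few f h = ℕₚ.*-cancelˡ-≤ (suc R) (begin
        suc R ℕ.* (4 ℕ.* f)        ≡⟨ solve 2 (λ r f → r :* (con 4 :* f) := con 4 :* (r :* f)) refl (suc R) f ⟩
        4 ℕ.* (suc R ℕ.* f)        ≤⟨ ℕₚ.*-monoʳ-≤ 4 h ⟩
        4 ℕ.* (N ℕ.* (κ ℕ.* M))    ≡⟨ solve 3 (λ n k m → con 4 :* (n :* (k :* m)) := n :* (con 4 :* (k :* m))) refl N κ M ⟩
        N ℕ.* (4 ℕ.* (κ ℕ.* M))    ≤⟨ ℕₚ.*-monoʳ-≤ N R-large ⟩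
        N ℕ.* (N ℕ.* suc R)        ≡⟨ solve 2 (λ n r → n :* (n :* r) := r :* (n :* n)) refl N (suc R) ⟩
        suc R ℕ.* (N ℕ.* N)        ∎)

  -- With the sum over `t` innermost, a quadruple with `a′ ≢ a` is counted for at most one `t`, and
  -- for fixed `a`, `c` the ranks leave at most R² choices of `a′`, `c′`.
  close-pairs-count : ∀ {σ M} (fib : Fin σ → Fin N → Fin N → Fin M) R →
    (∀ {t t′ a c a′ c′} → a′ ≢ a → fib t a′ c′ ≡ fib t a c → fib t′ a′ c′ ≡ fib t′ a c → t ≡ t′) →
    ∑ (λ t → ∑ λ a → ∑ λ c → ι (Good R (fib t) a c)) ℕ.≤ N ℕ.* (N ℕ.* (R ℕ.* R))
  close-pairs-count {σ} fib R determined = begin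
    ∑ (λ t → ∑ λ a → ∑ λ c → ι (Good R (fib t) a c))
      ≡⟨ sym (∑-comm₃ λ a c t → ι (Good R (fib t) a c)) ⟩
    ∑ (λ a → ∑ λ c → ∑ λ t → ι (Good R (fib t) a c))
      ≤⟨ ∑-≤ (λ a → ∑-≤ λ c → pair a c) ⟩
    N ℕ.* (N ℕ.* (R ℕ.* R)) ∎
    where
    open ℕₚ.≤-Reasoning
    pair : ∀ a c → ∑ (λ t → ι (Good R (fib t) a c)) ℕ.≤ R ℕ.* R
    pair a c = begin
      ∑ (λ t → ι (Good R (fib t) a c))
        ≤⟨ ∑-mono (λ t → ℕₚ.≤-trans (ι-∃≤∑ (λ a′ → ∃ λ c′ → ClosePair R (fib t) a c a′ c′))
             (∑-mono λ a′ → ι-∃≤∑ λ c′ → ClosePair R (fib t) a c a′ c′)) ⟩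
      ∑ (λ t → ∑ λ a′ → ∑ λ c′ → ι (ClosePair R (fib t) a c a′ c′))
        ≡⟨ sym (∑-comm₃ λ a′ c′ t → ι (ClosePair R (fib t) a c a′ c′)) ⟩
      ∑ (λ a′ → ∑ λ c′ → ∑ λ t → ι (ClosePair R (fib t) a c a′ c′))
        ≤⟨ ∑-mono (λ a′ → ∑-mono λ c′ → ℕₚ.≤-trans
             (∑≤ι-∃ (λ t → ClosePair R (fib t) a c a′ c′) λ { t t′ (ne , eq , _) (_ , eq′ , _) → determined ne eq eq′ })
             (ι-×-≤ λ { (_ , _ , _ , p , q) → p , q })) ⟩
      ∑ (λ a′ → ∑ λ c′ → ι (rank a a′ ℕ.≤ R) ℕ.* ι (rank c c′ ℕ.≤ R))
        ≡⟨ sum-cong-≗ (λ a′ → sym (*-distribˡ-sum (ι (rank a a′ ℕ.≤ R)) λ c′ → ι (rank c c′ ℕ.≤ R))) ⟩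
      ∑ (λ a′ → ι (rank a a′ ℕ.≤ R) ℕ.* ∑ λ c′ → ι (rank c c′ ℕ.≤ R))
        ≤⟨ ∑-mono (λ a′ → ℕₚ.*-monoʳ-≤ (ι (rank a a′ ℕ.≤ R)) (rank-count R c)) ⟩
      ∑ (λ a′ → ι (rank a a′ ℕ.≤ R) ℕ.* R)
        ≡⟨ *-distribʳ-sum R (λ a′ → ι (rank a a′ ℕ.≤ R)) ⟨
      ∑ (λ a′ → ι (rank a a′ ℕ.≤ R)) ℕ.* R
        ≤⟨ ℕₚ.*-monoˡ-≤ R (rank-count R a) ⟩
      R ℕ.* R ∎

  family-bound : .{{_ : ℕ.NonZero N}} → ∀ {σ M} (fib : Fin σ → Fin N → Fin N → Fin M) →
    (∀ t → Similarity (fib t)) →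
    (∀ {t t′ a c a′ c′} → a′ ≢ a → fib t a′ c′ ≡ fib t a c → fib t′ a′ c′ ≡ fib t′ a c → t ≡ t′) →
    4 ℕ.* M ℕ.≤ N ℕ.* N →
    σ ℕ.* (N ℕ.* N) ℕ.≤ 64 ℕ.* (κ ℕ.* κ) ℕ.* (M ℕ.* M)
  family-bound {σ} {M} fib similarity determined M-small = begin
    σ ℕ.* (N ℕ.* N)
      ≤⟨ ∑-≥ (λ t → Fibres.good-count (fib t) (similarity t) R M-small R-large) ⟩
    ∑ (λ t → 4 ℕ.* ∑ λ a → ∑ λ c → ι (Good R (fib t) a c))
      ≡⟨ *-distribˡ-sum 4 (λ t → ∑ λ a → ∑ λ c → ι (Good R (fib t) a c)) ⟨
    4 ℕ.* ∑ (λ t → ∑ λ a → ∑ λ c → ι (Good R (fib t) a c))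
      ≤⟨ ℕₚ.*-monoʳ-≤ 4 (close-pairs-count fib R determined) ⟩
    4 ℕ.* (N ℕ.* (N ℕ.* (R ℕ.* R)))
      ≡⟨ solve 2 (λ n r → con 4 :* (n :* (n :* (r :* r))) := con 4 :* ((r :* n) :* (r :* n))) refl N R ⟩
    4 ℕ.* ((R ℕ.* N) ℕ.* (R ℕ.* N))
      ≤⟨ ℕₚ.*-monoʳ-≤ 4 (ℕₚ.*-mono-≤ (ℕᵈ.m/n*n≤m L N) (ℕᵈ.m/n*n≤m L N)) ⟩
    4 ℕ.* (L ℕ.* L)
      ≡⟨ solve 2 (λ k m → con 4 :* ((con 4 :* (k :* m)) :* (con 4 :* (k :* m)))
                   := con 64 :* (k :* k) :* (m :* m)) refl κ M ⟩
    64 ℕ.* (κ ℕ.* κ) ℕ.* (M ℕ.* M) ∎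
    where
    open ℕₚ.≤-Reasoning
    open +-*-Solver using (solve; _:=_; _:+_; _:*_; con)
    -- Rounding down serves both sides: `N · suc R ≥ L` is what `good-count` asks for, and
    -- `R · N ≤ L` keeps the final count quadratic in M / N.
    L = 4 ℕ.* (κ ℕ.* M)
    R = L ℕ./ N
    R-large : L ℕ.≤ N ℕ.* suc R
    R-large = begin
      L                       ≡⟨ ℕᵈ.m≡m%n+[m/n]*n L N ⟩
      L ℕ.% N ℕ.+ R ℕ.* N     ≤⟨ ℕₚ.+-monoˡ-≤ (R ℕ.* N) (ℕₚ.<⇒≤ (ℕᵈ.m%n<n L N)) ⟩
      suc R ℕ.* N             ≡⟨ ℕₚ.*-comm (suc R) N ⟩
      N ℕ.* suc R             ∎

-- Reals

open ℚSolver.+-*-Solver using (solve; _:=_; _:+_; _:*_; _:-_; :-_; con)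

p≤∣p∣ : ∀ p → p ℚ.≤ ∣ p ∣
p≤∣p∣ p with ℚₚ.∣p∣≡p∨∣p∣≡-p p
... | inj₁ eq = ℚₚ.≤-reflexive (sym eq)
... | inj₂ eq with ℚₚ.≤-total p 0ℚ
...   | inj₁ p≤0 = ℚₚ.≤-trans p≤0 (ℚₚ.0≤∣p∣ p)
...   | inj₂ 0≤p = ℚₚ.≤-reflexive (sym (ℚₚ.0≤p⇒∣p∣≡p 0≤p))

abs-< : ∀ {p ε} → p ℚ.< ε → ℚ.- p ℚ.< ε → ∣ p ∣ ℚ.< ε
abs-< {p} {ε} p<ε -p<ε with ℚₚ.∣p∣≡p∨∣p∣≡-p p
... | inj₁ eq = subst (ℚ._< ε) (sym eq) p<ε
... | inj₂ eq = subst (ℚ._< ε) (sym eq) -p<ε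

∣p-q∣≡∣q-p∣ : ∀ p q → ∣ p ℚ.- q ∣ ≡ ∣ q ℚ.- p ∣
∣p-q∣≡∣q-p∣ p q = trans (sym (ℚₚ.∣-p∣≡∣p∣ (p ℚ.- q)))
  (cong ∣_∣ (solve 2 (λ p q → :- (p :- q) := q :- p) refl p q))

½+½ : ∀ ε → ε ℚ.* ½ ℚ.+ ε ℚ.* ½ ≡ ε
½+½ = solve 1 (λ ε → ε :* con ½ :+ ε :* con ½ := ε) refl

*-positive : ∀ {p q} → 0ℚ ℚ.< p → 0ℚ ℚ.< q → 0ℚ ℚ.< p ℚ.* q
*-positive {p} {q} p>0 q>0 =
  ℚₚ.positive⁻¹ (p ℚ.* q) {{ℚₚ.pos*pos⇒pos p {{ℚ.positive p>0}} q {{ℚ.positive q>0}}}}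

½-positive : ∀ {ε} → 0ℚ ℚ.< ε → 0ℚ ℚ.< ε ℚ.* ½
½-positive ε>0 = *-positive ε>0 (ℚₚ.positive⁻¹ ½)

*-mono-≤ : ∀ {p q r s} → 0ℚ ℚ.≤ p → 0ℚ ℚ.≤ s → p ℚ.≤ q → r ℚ.≤ s → p ℚ.* r ℚ.≤ q ℚ.* s
*-mono-≤ {p} {q} {r} {s} 0≤p 0≤s p≤q r≤s = ℚₚ.≤-trans
  (ℚₚ.*-monoˡ-≤-nonNeg p {{ℚ.nonNegative 0≤p}} r≤s)
  (ℚₚ.*-monoʳ-≤-nonNeg s {{ℚ.nonNegative 0≤s}} p≤q)

reciprocal : ∀ {p} → 0ℚ ℚ.< p → ∃[ r ] (0ℚ ℚ.< r × p ℚ.* r ≡ 1ℚ)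
reciprocal {p} p>0 = (ℚ.1/ p) {{nz}} ,
  ℚₚ.positive⁻¹ _ {{ℚₚ.1/pos⇒pos p {{ℚ.positive p>0}}}} , ℚₚ.*-inverseʳ p {{nz}}
  where nz = ℚₚ.pos⇒nonZero p {{ℚ.positive p>0}}

≤-lower : ∀ {a b δ} → ∣ a ℚ.- b ∣ ℚ.< δ → a ℚ.- δ ℚ.≤ b
≤-lower {a} {b} {δ} h = begin
  a ℚ.- δ          ≤⟨ ℚₚ.+-monoʳ-≤ a (ℚₚ.neg-antimono-≤ (ℚₚ.≤-trans (p≤∣p∣ (a ℚ.- b)) (ℚₚ.<⇒≤ h))) ⟩
  a ℚ.- (a ℚ.- b)  ≡⟨ solve 2 (λ a b → a :- (a :- b) := b) refl a b ⟩
  b                ∎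
  where open ℚₚ.≤-Reasoning

-- Null sequences and equality of reals

Eventually : (ℕ → Set) → Set
Eventually P = ∃[ M ] (∀ n → M ℕ.≤ n → P n)

eventually-× : ∀ {P Q R : ℕ → Set} → (∀ n → P n → Q n → R n) →
  Eventually P → Eventually Q → Eventually R
eventually-× f (M , p) (M′ , q) = M ℕ.⊔ M′ , λ n le →
  f n (p n (ℕₚ.m⊔n≤o⇒m≤o M M′ le)) (q n (ℕₚ.m⊔n≤o⇒n≤o M M′ le))

eventually-map : ∀ {P Q : ℕ → Set} → (∀ n → P n → Q n) → Eventually P → Eventually Q
eventually-map f (M , p) = M , λ n le → f n (p n le)

record Null (f : ℕ → ℚ) : Set where
  constructor null
  field vanish : ∀ ε → 0ℚ ℚ.< ε → Eventually (λ n → ∣ f n ∣ ℚ.< ε)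

open Null

null-≗ : ∀ {f g} → (∀ n → f n ≡ g n) → Null f → Null g
null-≗ eq nf = null λ ε ε>0 →
  eventually-map (λ n → subst (λ q → ∣ q ∣ ℚ.< ε) (eq n)) (vanish nf ε ε>0)

null-+ : ∀ {f g} → Null f → Null g → Null (λ n → f n ℚ.+ g n)
null-+ {f} {g} nf ng = null λ ε ε>0 → eventually-× (step ε)
  (vanish nf _ (½-positive ε>0)) (vanish ng _ (½-positive ε>0))
  where
  step : ∀ ε n → ∣ f n ∣ ℚ.< ε ℚ.* ½ → ∣ g n ∣ ℚ.< ε ℚ.* ½ → ∣ f n ℚ.+ g n ∣ ℚ.< ε
  step ε n p q = subst (∣ f n ℚ.+ g n ∣ ℚ.<_) (½+½ ε)
    (ℚₚ.≤-<-trans (ℚₚ.∣p+q∣≤∣p∣+∣q∣ (f n) (g n)) (ℚₚ.+-mono-< p q))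

null-neg : ∀ {f} → Null f → Null (λ n → ℚ.- f n)
null-neg {f} nf = null λ ε ε>0 →
  eventually-map (λ n → subst (ℚ._< ε) (sym (ℚₚ.∣-p∣≡∣p∣ (f n)))) (vanish nf ε ε>0)

null-* : ∀ {f g : ℕ → ℚ} {B : ℚ} → 0ℚ ℚ.< B → Eventually (λ n → ∣ f n ∣ ℚ.≤ B) → Null g →
  Null (λ n → f n ℚ.* g n)
null-* {f} {g} {B} B>0 bf ng with reciprocal B>0
... | r , r>0 , Br≡1 = null λ ε ε>0 →
  eventually-× (step ε) bf (vanish ng (ε ℚ.* r) (*-positive ε>0 r>0))
  where
  open ℚₚ.≤-Reasoning
  step : ∀ ε n → ∣ f n ∣ ℚ.≤ B → ∣ g n ∣ ℚ.< ε ℚ.* r → ∣ f n ℚ.* g n ∣ ℚ.< ε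
  step ε n p q = begin-strict
    ∣ f n ℚ.* g n ∣      ≡⟨ ℚₚ.∣p*q∣≡∣p∣*∣q∣ (f n) (g n) ⟩
    ∣ f n ∣ ℚ.* ∣ g n ∣  ≤⟨ ℚₚ.*-monoʳ-≤-nonNeg ∣ g n ∣ {{ℚₚ.∣-∣-nonNeg (g n)}} p ⟩
    B ℚ.* ∣ g n ∣        <⟨ ℚₚ.*-monoʳ-<-pos B {{ℚ.positive B>0}} q ⟩
    B ℚ.* (ε ℚ.* r)      ≡⟨ solve 3 (λ b e r → b :* (e :* r) := e :* (b :* r)) refl B ε r ⟩
    ε ℚ.* (B ℚ.* r)      ≡⟨ cong (ε ℚ.*_) Br≡1 ⟩
    ε ℚ.* 1ℚ             ≡⟨ ℚₚ.*-identityʳ ε ⟩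
    ε                    ∎

bounded : ∀ x → ∃[ B ] (0ℚ ℚ.< B × Eventually (λ n → ∣ seq x n ∣ ℚ.≤ B))
bounded x with cauchy x 1ℚ (ℚₚ.positive⁻¹ 1ℚ)
... | M , hx = 1ℚ ℚ.+ ∣ seq x M ∣
             , ℚₚ.+-mono-<-≤ (ℚₚ.positive⁻¹ 1ℚ) (ℚₚ.0≤∣p∣ (seq x M))
             , M , λ n le → begin
  ∣ seq x n ∣
    ≡⟨ cong ∣_∣ (solve 2 (λ a b → a := (a :- b) :+ b) refl (seq x n) (seq x M)) ⟩
  ∣ (seq x n ℚ.- seq x M) ℚ.+ seq x M ∣
    ≤⟨ ℚₚ.∣p+q∣≤∣p∣+∣q∣ (seq x n ℚ.- seq x M) (seq x M) ⟩
  ∣ seq x n ℚ.- seq x M ∣ ℚ.+ ∣ seq x M ∣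
    ≤⟨ ℚₚ.+-monoˡ-≤ ∣ seq x M ∣ (ℚₚ.<⇒≤ (hx n M le ℕₚ.≤-refl)) ⟩
  1ℚ ℚ.+ ∣ seq x M ∣ ∎
  where open ℚₚ.≤-Reasoning

-- Wrapping _≈_ (and positivity below) in a record lets Agda infer the reals compared.
infix 4 _≃_
record _≃_ (x y : ℝ) : Set where
  constructor ≃-of
  field ≈-of : x ≈ y

open _≃_

difference-null : ∀ {x y} → x ≃ y → Null (λ n → seq x n ℚ.- seq y n)
difference-null p = null (≈-of p)

null-difference : ∀ {x y} → Null (λ n → seq x n ℚ.- seq y n) → x ≃ y
null-difference p = ≃-of (vanish p)

≃-pointwise : ∀ {x y} → (∀ n → seq x n ≡ seq y n) → x ≃ y
≃-pointwise {x} {y} eq = ≃-of λ ε ε>0 → 0 , λ n _ → subst (λ q → ∣ q ∣ ℚ.< ε)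
  (sym (trans (cong (ℚ._- seq y n) (eq n)) (ℚₚ.+-inverseʳ (seq y n)))) ε>0

≃-refl : ∀ {x} → x ≃ x
≃-refl = ≃-pointwise λ _ → refl

≃-sym : ∀ {x y} → x ≃ y → y ≃ x
≃-sym {x} {y} p = ≃-of λ ε ε>0 → eventually-map
  (λ n → subst (ℚ._< ε) (∣p-q∣≡∣q-p∣ (seq x n) (seq y n))) (≈-of p ε ε>0)

≃-trans : ∀ {x y z} → x ≃ y → y ≃ z → x ≃ z
≃-trans {x} {y} {z} p q = null-difference (null-≗
  (λ n → solve 3 (λ a b c → (a :- b) :+ (b :- c) := a :- c) refl (seq x n) (seq y n) (seq z n))
  (null-+ (difference-null p) (difference-null q)))

+-cong : ∀ {x x′ y y′} → x ≃ x′ → y ≃ y′ → x + y ≃ x′ + y′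
+-cong {x} {x′} {y} {y′} p q = null-difference (null-≗
  (λ n → solve 4 (λ a b c d → (a :- b) :+ (c :- d) := (a :+ c) :- (b :+ d)) refl
    (seq x n) (seq x′ n) (seq y n) (seq y′ n))
  (null-+ (difference-null p) (difference-null q)))

-‿cong : ∀ {x x′ y y′} → x ≃ x′ → y ≃ y′ → x - y ≃ x′ - y′
-‿cong {x} {x′} {y} {y′} p q = null-difference (null-≗
  (λ n → solve 4 (λ a b c d → (a :- b) :+ :- (c :- d) := (a :- c) :- (b :- d)) refl
    (seq x n) (seq x′ n) (seq y n) (seq y′ n))
  (null-+ (difference-null p) (null-neg (difference-null q))))

*-cong : ∀ {x x′ y y′} → x ≃ x′ → y ≃ y′ → x * y ≃ x′ * y′
*-cong {x} {x′} {y} {y′} p q =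
  let _ , B>0 , bx = bounded x
      _ , B′>0 , by = bounded y′
  in null-difference (null-≗
  (λ n → solve 4 (λ a b c d → a :* (c :- d) :+ d :* (a :- b) := a :* c :- b :* d) refl
    (seq x n) (seq x′ n) (seq y n) (seq y′ n))
  (null-+ (null-* {f = seq x} B>0 bx (difference-null q))
    (null-* {f = seq y′} B′>0 by (difference-null p))))

≃-zero : ∀ {x y} → x ≃ y → x - y ≃ 0ℝ
≃-zero {x} {y} p = null-difference (null-≗
  (λ n → solve 2 (λ a b → a :- b := (a :- b) :- con 0ℚ) refl (seq x n) (seq y n))
  (difference-null p))

zero-≃ : ∀ {x y} → x - y ≃ 0ℝ → x ≃ y
zero-≃ {x} {y} p = null-difference (null-≗
  (λ n → solve 2 (λ a b → (a :- b) :- con 0ℚ := a :- b) refl (seq x n) (seq y n))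
  (difference-null p))

-- Positive and nonnegative reals

record Pos (x : ℝ) : Set where
  constructor pos
  field
    {ε}  : ℚ
    ε>0  : 0ℚ ℚ.< ε
    ε≤   : Eventually (λ n → ε ℚ.≤ seq x n)

<⇒pos : ∀ {x y} → x < y → Pos (y - x)
<⇒pos {x} {y} (ε , ε>0 , ev) = pos ε>0 (eventually-map
  (λ n le → subst (ℚ._≤ seq y n ℚ.- seq x n)
    (solve 2 (λ a e → (a :+ e) :- a := e) refl (seq x n) ε)
    (ℚₚ.+-monoˡ-≤ (ℚ.- seq x n) le)) ev)

pos⇒< : ∀ {x y} → Pos (y - x) → x < y
pos⇒< {x} {y} (pos {ε} ε>0 ev) = ε , ε>0 , eventually-map
  (λ n le → subst (seq x n ℚ.+ ε ℚ.≤_)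
    (solve 2 (λ a b → a :+ (b :- a) := b) refl (seq x n) (seq y n))
    (ℚₚ.+-monoʳ-≤ (seq x n) le)) ev

half-below : ∀ {a b ε} → ε ℚ.≤ a → ∣ a ℚ.- b ∣ ℚ.< ε ℚ.* ½ → ε ℚ.* ½ ℚ.≤ b
half-below {a} {b} {ε} ε≤a d = ℚₚ.≤-trans
  (subst (ℚ._≤ a ℚ.- ε ℚ.* ½)
    (solve 1 (λ e → e :- e :* con ½ := e :* con ½) refl ε)
    (ℚₚ.+-monoˡ-≤ (ℚ.- (ε ℚ.* ½)) ε≤a))
  (≤-lower {a} {b} d)

pos-≃ : ∀ {x y} → x ≃ y → Pos x → Pos y
pos-≃ {x} {y} x≃y (pos {ε} ε>0 ev) = pos (½-positive ε>0)
  (eventually-× (λ n d le → half-below {seq x n} {seq y n} le d)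
    (≈-of x≃y (ε ℚ.* ½) (½-positive ε>0)) ev)

pos-+ : ∀ {x y} → Pos x → Pos y → Pos (x + y)
pos-+ (pos ε>0 ev) (pos δ>0 ev′) = pos (ℚₚ.+-mono-< ε>0 δ>0)
  (eventually-× (λ _ → ℚₚ.+-mono-≤) ev ev′)

pos-* : ∀ {x y} → Pos x → Pos y → Pos (x * y)
pos-* (pos ε>0 ev) (pos δ>0 ev′) = pos (*-positive ε>0 δ>0)
  (eventually-× (λ _ p q → *-mono-≤ (ℚₚ.<⇒≤ ε>0) (ℚₚ.≤-trans (ℚₚ.<⇒≤ δ>0) q) p q) ev ev′)

pos-irrefl : ¬ Pos 0ℝ
pos-irrefl (pos ε>0 (M , le)) = ℚₚ.<-irrefl refl (ℚₚ.<-≤-trans ε>0 (le M ℕₚ.≤-refl))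

-- Beyond a modulus of Cauchyness at ε/2, a single term of size ε fixes the sign of x.
pos-of-term : ∀ x {ε M} → 0ℚ ℚ.< ε →
  (∀ m n → M ℕ.≤ m → M ℕ.≤ n → ∣ seq x m ℚ.- seq x n ∣ ℚ.< ε ℚ.* ½) →
  ∀ n → M ℕ.≤ n → ε ℚ.≤ seq x n → Pos x
pos-of-term x {ε} {M} ε>0 hx n M≤n ε≤xn = pos (½-positive ε>0) (M , λ m M≤m →
  half-below {seq x n} {seq x m} ε≤xn (hx n m M≤n M≤m))

-- Past the modulus for ε/2 no term of x or of -x can reach ε, since by `pos-of-term` a single such
-- term would make that real positive.
not-pos⇒≃0 : ∀ x → ¬ Pos x → ¬ Pos (0ℝ - x) → x ≃ 0ℝ
not-pos⇒≃0 x ¬p ¬n = ≃-of small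
  where
  small : x ≈ 0ℝ
  small ε ε>0 with cauchy x (ε ℚ.* ½) (½-positive ε>0)
                 | cauchy (0ℝ - x) (ε ℚ.* ½) (½-positive ε>0)
  ... | M , hx | M′ , hx′ = M ℕ.⊔ M′ , λ n le →
    abs-<
      (subst (ℚ._< ε) (sym (ℚₚ.+-identityʳ (seq x n)))
        (ℚₚ.≰⇒> λ h → ¬p (pos-of-term x ε>0 hx n (ℕₚ.m⊔n≤o⇒m≤o M M′ le) h)))
      (subst (ℚ._< ε) (solve 1 (λ a → con 0ℚ :- a := :- (a :- con 0ℚ)) refl (seq x n))
        (ℚₚ.≰⇒> λ h → ¬n (pos-of-term (0ℝ - x) ε>0 hx′ n (ℕₚ.m⊔n≤o⇒n≤o M M′ le) h)))

-- `_≤_` is a negation and carries no data; this disjunction lets sums and products be treated by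
-- cases. Excluded middle converts the one into the other in `≤⇒nonneg`.
Nonneg : ℝ → Set
Nonneg x = Pos x ⊎ x ≃ 0ℝ

nonneg-≃ : ∀ {x y} → x ≃ y → Nonneg x → Nonneg y
nonneg-≃ x≃y (inj₁ p) = inj₁ (pos-≃ x≃y p)
nonneg-≃ x≃y (inj₂ z) = inj₂ (≃-trans (≃-sym x≃y) z)

pos-nonneg-+ : ∀ {x y} → Pos x → Nonneg y → Pos (x + y)
pos-nonneg-+ p (inj₁ q) = pos-+ p q
pos-nonneg-+ {x} {y} p (inj₂ z) = pos-≃
  (≃-trans (≃-pointwise {x} {x + 0ℝ} λ n → sym (ℚₚ.+-identityʳ (seq x n))) (+-cong ≃-refl (≃-sym z))) p

nonneg-+ : ∀ {x y} → Nonneg x → Nonneg y → Nonneg (x + y)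
nonneg-+ (inj₁ p) q = inj₁ (pos-nonneg-+ p q)
nonneg-+ {x} {y} (inj₂ z) q = nonneg-≃
  (≃-trans (≃-pointwise {y} {0ℝ + y} λ n → sym (ℚₚ.+-identityˡ (seq y n))) (+-cong (≃-sym z) ≃-refl)) q

zero-*ˡ : ∀ {x} y → x ≃ 0ℝ → x * y ≃ 0ℝ
zero-*ˡ y z = ≃-trans (*-cong z ≃-refl) (≃-pointwise λ n → ℚₚ.*-zeroˡ (seq y n))

zero-*ʳ : ∀ x {y} → y ≃ 0ℝ → x * y ≃ 0ℝ
zero-*ʳ x z = ≃-trans (*-cong ≃-refl z) (≃-pointwise λ n → ℚₚ.*-zeroʳ (seq x n))

nonneg-* : ∀ {x y} → Nonneg x → Nonneg y → Nonneg (x * y)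
nonneg-* (inj₁ p) (inj₁ q) = inj₁ (pos-* p q)
nonneg-* {x} {y} (inj₂ z) _        = inj₂ (zero-*ˡ y z)
nonneg-* {x} {y} (inj₁ _) (inj₂ z) = inj₂ (zero-*ʳ x z)

pos-fromℚ : ∀ {q} → 0ℚ ℚ.< q → Pos (fromℚ q)
pos-fromℚ q>0 = pos q>0 (0 , λ _ _ → ℚₚ.≤-refl)

nonneg-fromℚ : ∀ {q} → 0ℚ ℚ.≤ q → Nonneg (fromℚ q)
nonneg-fromℚ {q} q≥0 with 0ℚ ℚₚ.<? q
... | yes q>0 = inj₁ (pos-fromℚ q>0)
... | no q≯0  = inj₂ (≃-pointwise λ _ → ℚₚ.≤-antisym (ℚₚ.≮⇒≥ q≯0) q≥0)

-- A positive x satisfies ε ≤ xₙ eventually; the reciprocals of max(xₙ, ε) are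
-- defined for every n and are Cauchy, being ε⁻²-Lipschitz in xₙ.
inverse : ∀ x → Pos x → ∃[ y ] x * y ≃ 1ℝ
inverse x (pos {ε} ε>0 (M₀ , ε≤x)) = mkℝ y cauchy-y , ≃-of λ δ δ>0 →
  M₀ , λ n le → subst (ℚ._< δ)
    (cong ∣_∣ (sym (trans (cong (λ a → a ℚ.* y n ℚ.- 1ℚ) (sym (a≡x n le)))
      (trans (cong (ℚ._- 1ℚ) (ay n)) (ℚₚ.+-inverseʳ 1ℚ))))) δ>0
  where
  a : ℕ → ℚ
  a n = seq x n ℚ.⊔ ε
  ε≤a : ∀ n → ε ℚ.≤ a n
  ε≤a n = ℚₚ.p≤q⊔p (seq x n) ε
  a>0 : ∀ n → 0ℚ ℚ.< a n
  a>0 n = ℚₚ.<-≤-trans ε>0 (ε≤a n)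
  y : ℕ → ℚ
  y n = proj₁ (reciprocal (a>0 n))
  y>0 : ∀ n → 0ℚ ℚ.< y n
  y>0 n = proj₁ (proj₂ (reciprocal (a>0 n)))
  ay : ∀ n → a n ℚ.* y n ≡ 1ℚ
  ay n = proj₂ (proj₂ (reciprocal (a>0 n)))
  a≡x : ∀ n → M₀ ℕ.≤ n → a n ≡ seq x n
  a≡x n le = ℚₚ.p≥q⇒p⊔q≡p (ε≤x n le)
  r = proj₁ (reciprocal ε>0)
  r>0 = proj₁ (proj₂ (reciprocal ε>0))
  εr = proj₂ (proj₂ (reciprocal ε>0))
  y≤r : ∀ n → y n ℚ.≤ r
  y≤r n = begin
    y n                  ≡⟨ trans (sym (ℚₚ.*-identityʳ (y n))) (cong (y n ℚ.*_) (sym εr)) ⟩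
    y n ℚ.* (ε ℚ.* r)    ≤⟨ ℚₚ.*-monoˡ-≤-nonNeg (y n) {{ℚ.nonNegative (ℚₚ.<⇒≤ (y>0 n))}}
                             (ℚₚ.*-monoʳ-≤-nonNeg r {{ℚ.nonNegative (ℚₚ.<⇒≤ r>0)}} (ε≤a n)) ⟩
    y n ℚ.* (a n ℚ.* r)  ≡⟨ solve 3 (λ a y r → y :* (a :* r) := (a :* y) :* r) refl (a n) (y n) r ⟩
    (a n ℚ.* y n) ℚ.* r  ≡⟨ trans (cong (ℚ._* r) (ay n)) (ℚₚ.*-identityˡ r) ⟩
    r                    ∎
    where open ℚₚ.≤-Reasoning
  cauchy-y : IsCauchy y
  cauchy-y δ δ>0 with cauchy x (δ ℚ.* (ε ℚ.* ε)) (*-positive δ>0 (*-positive ε>0 ε>0))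
  ... | M , hx = M ℕ.⊔ M₀ , λ m n p q → close m n
          (ℕₚ.m⊔n≤o⇒n≤o M M₀ p) (ℕₚ.m⊔n≤o⇒n≤o M M₀ q)
          (hx n m (ℕₚ.m⊔n≤o⇒m≤o M M₀ q) (ℕₚ.m⊔n≤o⇒m≤o M M₀ p))
    where
    open ℚₚ.≤-Reasoning
    close : ∀ m n → M₀ ℕ.≤ m → M₀ ℕ.≤ n →
      ∣ seq x n ℚ.- seq x m ∣ ℚ.< δ ℚ.* (ε ℚ.* ε) → ∣ y m ℚ.- y n ∣ ℚ.< δ
    close m n p q h = begin-strict
      ∣ y m ℚ.- y n ∣
        ≡⟨ cong ∣_∣ (trans (cong₂ ℚ._-_ (sym (ℚₚ.*-identityʳ (y m))) (sym (ℚₚ.*-identityʳ (y n))))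
             (trans (cong₂ (λ u v → y m ℚ.* u ℚ.- y n ℚ.* v) (sym (ay n)) (sym (ay m)))
             (solve 4 (λ u v b c → u :* (c :* v) :- v :* (b :* u) := (u :* v) :* (c :- b)) refl
               (y m) (y n) (a m) (a n)))) ⟩
      ∣ (y m ℚ.* y n) ℚ.* (a n ℚ.- a m) ∣
        ≡⟨ trans (ℚₚ.∣p*q∣≡∣p∣*∣q∣ (y m ℚ.* y n) (a n ℚ.- a m))
             (cong₂ ℚ._*_ (ℚₚ.0≤p⇒∣p∣≡p (ℚₚ.<⇒≤ (*-positive (y>0 m) (y>0 n))))
               (cong₂ (λ u v → ∣ u ℚ.- v ∣) (a≡x n q) (a≡x m p))) ⟩
      (y m ℚ.* y n) ℚ.* ∣ seq x n ℚ.- seq x m ∣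
        <⟨ ℚₚ.*-monoʳ-<-pos (y m ℚ.* y n) {{ℚ.positive (*-positive (y>0 m) (y>0 n))}} h ⟩
      (y m ℚ.* y n) ℚ.* (δ ℚ.* (ε ℚ.* ε))
        ≤⟨ ℚₚ.*-monoʳ-≤-nonNeg (δ ℚ.* (ε ℚ.* ε))
             {{ℚ.nonNegative (ℚₚ.<⇒≤ (*-positive δ>0 (*-positive ε>0 ε>0)))}}
             (*-mono-≤ (ℚₚ.<⇒≤ (y>0 m)) (ℚₚ.<⇒≤ r>0) (y≤r m) (y≤r n)) ⟩
      (r ℚ.* r) ℚ.* (δ ℚ.* (ε ℚ.* ε))
        ≡⟨ solve 3 (λ r d e → (r :* r) :* (d :* (e :* e)) := d :* ((e :* r) :* (e :* r))) refl r δ ε ⟩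
      δ ℚ.* ((ε ℚ.* r) ℚ.* (ε ℚ.* r))
        ≡⟨ trans (cong (λ u → δ ℚ.* (u ℚ.* u)) εr) (ℚₚ.*-identityʳ δ) ⟩
      δ ∎

nonneg⇒≤ : ∀ {x y} → Nonneg (y - x) → x ≤ y
nonneg⇒≤ {x} {y} p y<x = pos-irrefl (pos-≃
  (≃-pointwise λ n → solve 2 (λ a b → (a :- b) :+ (b :- a) := con 0ℚ) refl (seq x n) (seq y n))
  (pos-nonneg-+ (<⇒pos {y} {x} y<x) p))

pos-neg-⊥ : ∀ {x} → Nonneg x → Pos (0ℝ - x) → ⊥
pos-neg-⊥ {x} p q = pos-irrefl (pos-≃
  (≃-pointwise λ n → solve 1 (λ a → (con 0ℚ :- a) :+ a := con 0ℚ) refl (seq x n))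
  (pos-nonneg-+ q p))

nonneg-antisym : ∀ {x} → Nonneg x → Nonneg (0ℝ - x) → x ≃ 0ℝ
nonneg-antisym (inj₂ z) _ = z
nonneg-antisym (inj₁ p) (inj₁ q) = ⊥-elim (pos-neg-⊥ (inj₁ p) q)
nonneg-antisym {x} (inj₁ p) (inj₂ z) = ≃-trans
  (≃-pointwise λ n → solve 1 (λ a → a := con 0ℚ :- (con 0ℚ :- a)) refl (seq x n))
  (≃-trans (-‿cong {0ℝ} ≃-refl z) (≃-pointwise λ n → refl))

nonneg-+-zero : ∀ {x y} → Nonneg x → Nonneg y → x + y ≃ 0ℝ → x ≃ 0ℝ
nonneg-+-zero (inj₂ z) _ _ = z
nonneg-+-zero (inj₁ p) q z = ⊥-elim (pos-irrefl (pos-≃ z (pos-nonneg-+ p q)))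

-- Natural numbers inside the reals

nonneg-fromℕ : ∀ n → Nonneg (fromℕ n)
nonneg-fromℕ n = nonneg-fromℚ (ℚₚ.nonNegative⁻¹ _ {{ℚₚ.normalize-nonNeg n 1}})

toℚᵘ-ℕ : ∀ n → ℚ.toℚᵘ (+ n ℚ./ 1) ℚᵘ.≃ mkℚᵘ (+ n) 0
toℚᵘ-ℕ n = ℚₚ.toℚᵘ-fromℚᵘ (mkℚᵘ (+ n) 0)

-- Normalised fractions do not add by plain computation, so the identity is verified on unnormalised
-- ones and pulled back.
/1-+ : ∀ m n → + (m ℕ.+ n) ℚ./ 1 ≡ (+ m ℚ./ 1) ℚ.+ (+ n ℚ./ 1)
/1-+ m n = ℚₚ.toℚᵘ-injective (begin-equality
  ℚ.toℚᵘ (+ (m ℕ.+ n) ℚ./ 1)                  ≃⟨ toℚᵘ-ℕ (m ℕ.+ n) ⟩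
  mkℚᵘ (+ (m ℕ.+ n)) 0                        ≃⟨ *≡* (cong (ℤ._* 1ℤ) (sym (cong₂ ℤ._+_
                                                   (ℤₚ.*-identityʳ (+ m)) (ℤₚ.*-identityʳ (+ n))))) ⟩
  mkℚᵘ (+ m) 0 ℚᵘ.+ mkℚᵘ (+ n) 0              ≃⟨ ℚᵘₚ.+-cong (toℚᵘ-ℕ m) (toℚᵘ-ℕ n) ⟨
  ℚ.toℚᵘ (+ m ℚ./ 1) ℚᵘ.+ ℚ.toℚᵘ (+ n ℚ./ 1)  ≃⟨ ℚₚ.toℚᵘ-homo-+ (+ m ℚ./ 1) (+ n ℚ./ 1) ⟨
  ℚ.toℚᵘ ((+ m ℚ./ 1) ℚ.+ (+ n ℚ./ 1))        ∎)
  where open ℚᵘₚ.≤-Reasoning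

/1-* : ∀ m n → + (m ℕ.* n) ℚ./ 1 ≡ (+ m ℚ./ 1) ℚ.* (+ n ℚ./ 1)
/1-* m n = ℚₚ.toℚᵘ-injective (begin-equality
  ℚ.toℚᵘ (+ (m ℕ.* n) ℚ./ 1)                  ≃⟨ toℚᵘ-ℕ (m ℕ.* n) ⟩
  mkℚᵘ (+ (m ℕ.* n)) 0                        ≃⟨ *≡* (cong (ℤ._* 1ℤ) (ℤₚ.pos-* m n)) ⟩
  mkℚᵘ (+ m) 0 ℚᵘ.* mkℚᵘ (+ n) 0              ≃⟨ ℚᵘₚ.*-cong (toℚᵘ-ℕ m) (toℚᵘ-ℕ n) ⟨
  ℚ.toℚᵘ (+ m ℚ./ 1) ℚᵘ.* ℚ.toℚᵘ (+ n ℚ./ 1)  ≃⟨ ℚₚ.toℚᵘ-homo-* (+ m ℚ./ 1) (+ n ℚ./ 1) ⟨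
  ℚ.toℚᵘ ((+ m ℚ./ 1) ℚ.* (+ n ℚ./ 1))        ∎)
  where open ℚᵘₚ.≤-Reasoning

fromℕ-+ : ∀ m n → fromℕ (m ℕ.+ n) ≃ fromℕ m + fromℕ n
fromℕ-+ m n = ≃-pointwise λ _ → /1-+ m n

fromℕ-* : ∀ m n → fromℕ (m ℕ.* n) ≃ fromℕ m * fromℕ n
fromℕ-* m n = ≃-pointwise λ _ → /1-* m n

fromℕ-mono : ∀ {m n} → m ℕ.≤ n → Nonneg (fromℕ n - fromℕ m)
fromℕ-mono {m} {n} m≤n = nonneg-≃ (≃-trans
  (≃-pointwise {fromℕ (n ℕ.∸ m)} {(fromℕ (n ℕ.∸ m) + fromℕ m) - fromℕ m} λ _ →
    solve 2 (λ a b → a := (a :+ b) :- b) refl (+ (n ℕ.∸ m) ℚ./ 1) (+ m ℚ./ 1))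
  (-‿cong (≃-trans (≃-sym (fromℕ-+ (n ℕ.∸ m) m))
    (≃-pointwise λ _ → cong (λ k → + k ℚ./ 1) (ℕₚ.m∸n+n≡m m≤n))) ≃-refl))
  (nonneg-fromℕ (n ℕ.∸ m))

pos-fromℕ : ∀ n → .{{ℕ.NonZero n}} → Pos (fromℕ n)
pos-fromℕ n = pos-fromℚ (ℚₚ.positive⁻¹ _ {{ℚₚ.normalize-pos n 1}})

fromℕ-cancel : ∀ {m n} → Nonneg (fromℕ n - fromℕ m) → m ℕ.≤ n
fromℕ-cancel {m} {n} p with m ℕₚ.≤? n
... | yes m≤n = m≤n
-- Otherwise 1 > 0, m - (1 + n) ≥ 0 and n - m ≥ 0 would have sum 0.
... | no m≰n = ⊥-elim (pos-irrefl (pos-≃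
  (≃-trans
    (+-cong ≃-refl (+-cong (-‿cong ≃-refl (fromℕ-+ 1 n)) ≃-refl))
    (cancels (fromℕ 1) (fromℕ m) (fromℕ n)))
  (pos-nonneg-+ (pos-fromℕ 1) (nonneg-+ (fromℕ-mono (ℕₚ.≰⇒> m≰n)) p))))
  where
  cancels : ∀ o a b → o + ((a - (o + b)) + (b - a)) ≃ 0ℝ
  cancels o a b = ≃-pointwise λ k →
    solve 3 (λ o a b → o :+ ((a :- (o :+ b)) :+ (b :- a)) := con 0ℚ) refl (seq o k) (seq a k) (seq b k)

1/k≤1 : ∀ k → .{{_ : ℕ.NonZero k}} → 1ℤ ℚ./ k ℚ.≤ 1ℚ
1/k≤1 (suc k) = ℚₚ.toℚᵘ-cancel-≤ (ℚᵘₚ.≤-respˡ-≃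
  (ℚᵘₚ.≃-sym (ℚₚ.toℚᵘ-fromℚᵘ (mkℚᵘ 1ℤ k)))
  (*≤* (ℤ.+≤+ (ℕ.s≤s ℕ.z≤n))))

^-nonneg : ∀ {y} → Nonneg y → ∀ n → Nonneg (y ^ n)
^-nonneg p zero    = inj₁ (pos-fromℚ (ℚₚ.positive⁻¹ 1ℚ))
^-nonneg p (suc n) = nonneg-* p (^-nonneg p n)

^-mono : ∀ {x y} → Nonneg x → Nonneg (y - x) → Nonneg y → ∀ n → Nonneg (y ^ n - x ^ n)
^-mono p q r zero    = inj₂ (≃-pointwise λ _ → refl)
^-mono {x} {y} p q r (suc n) = nonneg-≃
  (≃-pointwise λ k → solve 4 (λ x y a b → (y :- x) :* b :+ x :* (b :- a) := y :* b :- x :* a) refl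
    (seq x k) (seq y k) (seq (x ^ n) k) (seq (y ^ n) k))
  (nonneg-+ (nonneg-* q (^-nonneg r n)) (nonneg-* p (^-mono p q r n)))

-- The exponential series at arguments up to one half

½ℝ 2ℝ : ℝ
½ℝ = fromℚ ½
2ℝ = fromℕ 2

nonneg-½ : Nonneg ½ℝ
nonneg-½ = nonneg-fromℚ (ℚₚ.<⇒≤ (ℚₚ.positive⁻¹ ½))

-- Termwise comparison with the geometric series of ratio ½.
expPartialSum-bound : ∀ {y} → Nonneg y → Nonneg (½ℝ - y) → ∀ n →
  Nonneg ((2ℝ - 2ℝ * ½ℝ ^ n) - expPartialSum y n)
expPartialSum-bound p q zero = inj₂ (≃-pointwise λ _ → refl)
expPartialSum-bound {y} p q (suc n) = nonneg-≃
  (≃-pointwise λ k → solve 4 (λ a b e c →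
      (((con (+ 2 ℚ./ 1) :- con (+ 2 ℚ./ 1) :* b) :- e) :+ (b :- a)) :+ a :* (con 1ℚ :- c)
      := (con (+ 2 ℚ./ 1) :- con (+ 2 ℚ./ 1) :* (con ½ :* b)) :- (e :+ a :* c)) refl
    (seq (y ^ n) k) (seq (½ℝ ^ n) k) (seq (expPartialSum y n) k) c)
  (nonneg-+ (nonneg-+ (expPartialSum-bound p q n) (^-mono p q nonneg-½ n))
    (nonneg-* (^-nonneg p n) 1-c≥0))
  where
  c = ℚ._/_ 1ℤ (n !) {{n !≢0}}
  1-c≥0 : Nonneg (1ℝ - fromℚ c)
  1-c≥0 = nonneg-≃ (≃-pointwise {fromℚ (1ℚ ℚ.- c)} λ _ → refl)
    (nonneg-fromℚ (subst (ℚ._≤ 1ℚ ℚ.- c) (ℚₚ.+-inverseʳ c)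
      (ℚₚ.+-monoˡ-≤ (ℚ.- c) (1/k≤1 (n !) {{n !≢0}}))))

below-2-⊥ : ∀ s z b → Pos (s - (z - 1ℝ)) → Nonneg (z - fromℕ 3) →
  Nonneg ((2ℝ - 2ℝ * b) - s) → Nonneg b → ⊥
below-2-⊥ s z b p q r t = pos-irrefl (pos-≃
  (≃-pointwise λ k → solve 3 (λ s z b →
      (s :- (z :- con 1ℚ)) :+ (((z :- con (+ 3 ℚ./ 1)) :+
        ((con (+ 2 ℚ./ 1) :- con (+ 2 ℚ./ 1) :* b) :- s)) :+ con (+ 2 ℚ./ 1) :* b) := con 0ℚ) refl
    (seq s k) (seq z k) (seq b k))
  (pos-nonneg-+ p (nonneg-+ (nonneg-+ q r) (nonneg-* (nonneg-fromℕ 2) t))))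

1ℝ-pos : Pos (1ℝ - 0ℝ)
1ℝ-pos = pos-≃ (≃-pointwise {1ℝ} λ _ → refl) (pos-fromℚ (ℚₚ.positive⁻¹ 1ℚ))

0<1ℝ : 0ℝ < 1ℝ
0<1ℝ = pos⇒< {0ℝ} {1ℝ} 1ℝ-pos

partialSum-near : ∀ {y z} → IsExp y z → ∃[ M ] Pos (expPartialSum y M - (z - 1ℝ))
partialSum-near {y} {z} e =
  let M , close = e 1ℝ 0<1ℝ
  in M , <⇒pos {z - 1ℝ} {expPartialSum y M} (proj₁ (close M ℕₚ.≤-refl))

-- For 0 ≤ y ≤ 1/2 all partial sums are at most 2, while convergence with tolerance 1 puts some
-- partial sum above z - 1 ≥ 2.
exp-≥½ : ∀ {y z} → Nonneg y → IsExp y z → Nonneg (z - fromℕ 3) → ¬ Nonneg (½ℝ - y)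
exp-≥½ {y} {z} p e q r =
  let M , close = partialSum-near {y} {z} e
  in below-2-⊥ (expPartialSum y M) z (½ℝ ^ M) close q
       (expPartialSum-bound {y} p r M) (^-nonneg {½ℝ} nonneg-½ M)

-- Signs of reals decided by excluded middle

module RealOrder (em : ExcludedMiddle 0ℓ) where

  sign : ∀ x → Nonneg x ⊎ Pos (0ℝ - x)
  sign x with em {Pos x} | em {Pos (0ℝ - x)}
  ... | yes p | _     = inj₁ (inj₁ p)
  ... | no ¬p | yes n = inj₂ n
  ... | no ¬p | no ¬n = inj₁ (inj₂ (not-pos⇒≃0 x ¬p ¬n))

  ≤⇒nonneg : ∀ {x y} → x ≤ y → Nonneg (y - x)
  ≤⇒nonneg {x} {y} x≤y with sign (y - x)
  ... | inj₁ p = p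
  ... | inj₂ n = ⊥-elim (x≤y (pos⇒< {y} {x} (pos-≃
    (≃-pointwise λ k → solve 2 (λ a b → con 0ℚ :- (b :- a) := a :- b) refl (seq x k) (seq y k)) n)))

  square-neg : ∀ x y → (0ℝ - x) * (0ℝ - y) ≃ x * y
  square-neg x y = ≃-pointwise λ k →
    solve 2 (λ a b → (con 0ℚ :- a) :* (con 0ℚ :- b) := a :* b) refl (seq x k) (seq y k)

  nonneg-square : ∀ x → Nonneg (x * x)
  nonneg-square x with sign x
  ... | inj₁ p = nonneg-* p p
  ... | inj₂ n = nonneg-≃ (square-neg x x) (inj₁ (pos-* n n))

  zero-or-pos-square : ∀ x → x ≃ 0ℝ ⊎ Pos (x * x)
  zero-or-pos-square x with sign x
  ... | inj₁ (inj₁ p) = inj₂ (pos-* p p)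
  ... | inj₁ (inj₂ z) = inj₁ z
  ... | inj₂ n        = inj₂ (pos-≃ (square-neg x x) (pos-* n n))

  square-zero : ∀ {x} → x * x ≃ 0ℝ → x ≃ 0ℝ
  square-zero {x} z with zero-or-pos-square x
  ... | inj₁ x≃0 = x≃0
  ... | inj₂ p   = ⊥-elim (pos-irrefl (pos-≃ z p))

  no-zero-divisors : ∀ {x y} → x * y ≃ 0ℝ → x ≃ 0ℝ ⊎ y ≃ 0ℝ
  no-zero-divisors {x} {y} z with zero-or-pos-square x | zero-or-pos-square y
  ... | inj₁ x≃0 | _        = inj₁ x≃0
  ... | inj₂ _   | inj₁ y≃0 = inj₂ y≃0
  ... | inj₂ p   | inj₂ q   = ⊥-elim (pos-irrefl (pos-≃
    (≃-trans (≃-pointwise {y = (x * y) * (x * y)} λ k →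
        solve 2 (λ a b → (a :* a) :* (b :* b) := (a :* b) :* (a :* b)) refl (seq x k) (seq y k))
      (zero-*ˡ (x * y) z))
    (pos-* p q)))

  nonneg-cancel : ∀ {x y} → Pos x → Nonneg (x * y) → Nonneg y
  nonneg-cancel {x} {y} p q with sign y
  ... | inj₁ r = r
  ... | inj₂ n = ⊥-elim (pos-neg-⊥ q (pos-≃
    (≃-pointwise λ k → solve 2 (λ a b → a :* (con 0ℚ :- b) := con 0ℚ :- a :* b) refl (seq x k) (seq y k))
    (pos-* p n)))

  -- The hypotheses are what equal sign bits provide: both reals are nonnegative, or both are
  -- negative.
  same-sign : ∀ {x y} → (Nonneg x → Nonneg y) → (Nonneg y → Nonneg x) → Nonneg (x * y)
  same-sign {x} {y} f g with sign x | sign y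
  ... | inj₁ p | _      = nonneg-* p (f p)
  ... | inj₂ m | inj₁ q = ⊥-elim (pos-neg-⊥ (g q) m)
  ... | inj₂ m | inj₂ n = nonneg-≃ (square-neg x y) (inj₁ (pos-* m n))

  -- With z = (u₁ + i u₂)(v₁ − i v₂) the third hypothesis and u₁v₁u₂v₂ ≥ 0 give
  -- Re z² ≥ 0, that is |z|² ≤ 2 (Re z)², while the last two give 4 (Re z)² ≤ |z|².
  octant : ∀ u₁ u₂ v₁ v₂ → Nonneg (u₁ * v₁) → Nonneg (u₂ * v₂) →
    Nonneg ((u₁ * u₁ - u₂ * u₂) * (v₁ * v₁ - v₂ * v₂)) →
    Nonneg ((u₁ * u₁ + u₂ * u₂) - 2ℝ * (u₁ * v₁ + u₂ * v₂)) →
    Nonneg ((v₁ * v₁ + v₂ * v₂) - 2ℝ * (u₁ * v₁ + u₂ * v₂)) →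
    (u₁ * u₁ + u₂ * u₂) * (v₁ * v₁ + v₂ * v₂) ≃ 0ℝ
  octant u₁ u₂ v₁ v₂ p q r s t = nonneg-antisym
    (nonneg-* (nonneg-+ (nonneg-square u₁) (nonneg-square u₂))
              (nonneg-+ (nonneg-square v₁) (nonneg-square v₂)))
    (nonneg-≃ (≃-pointwise λ k → solve 4 (λ a b c d →
        let two = con (+ 2 ℚ./ 1)
            dot = two :* (a :* c :+ b :* d)
            U   = a :* a :+ b :* b
            V   = c :* c :+ d :* d
        in ((U :- dot) :* (V :- dot) :+ dot :* ((U :- dot) :+ (V :- dot)))
           :+ two :* ((a :* a :- b :* b) :* (c :* c :- d :* d) :+ two :* (two :* ((a :* c) :* (b :* d))))
           := con 0ℚ :- U :* V) refl
        (seq u₁ k) (seq u₂ k) (seq v₁ k) (seq v₂ k))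
      (nonneg-+
        (nonneg-+ (nonneg-* s t) (nonneg-* (nonneg-* 2≥0 (nonneg-+ p q)) (nonneg-+ s t)))
        (nonneg-* 2≥0 (nonneg-+ r (nonneg-* 2≥0 (nonneg-* 2≥0 (nonneg-* p q)))))))
    where 2≥0 = nonneg-fromℕ 2

  bit : Set → Fin 2
  bit P with em {P}
  ... | yes _ = zero
  ... | no _  = suc zero

  bit-≡ : ∀ {P Q} → bit P ≡ bit Q → P → Q
  bit-≡ {P} {Q} eq p with em {P} | em {Q}
  bit-≡ eq p | yes _ | yes q = q
  bit-≡ () p | yes _ | no _
  bit-≡ eq p | no ¬p | _     = ⊥-elim (¬p p)

-- The complex plane

infixl 6 _-ᶜ_
_-ᶜ_ : ℂ → ℂ → ℂ
z -ᶜ w = mkℂ (re z - re w) (im z - im w)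

normSq : ℂ → ℝ
normSq z = re z * re z + im z * im z

infix 4 _≃ᶜ_
record _≃ᶜ_ (z w : ℂ) : Set where
  constructor _,ᶜ_
  field
    re-≃ : re z ≃ re w
    im-≃ : im z ≃ im w

open _≃ᶜ_

≈ᶜ⇒≃ᶜ : ∀ {z w} → z ≈ᶜ w → z ≃ᶜ w
≈ᶜ⇒≃ᶜ (p , q) = ≃-of p ,ᶜ ≃-of q

≃ᶜ⇒≈ᶜ : ∀ {z w} → z ≃ᶜ w → z ≈ᶜ w
≃ᶜ⇒≈ᶜ (p ,ᶜ q) = ≈-of p , ≈-of q

≃ᶜ-refl : ∀ {z} → z ≃ᶜ z
≃ᶜ-refl = ≃-refl ,ᶜ ≃-refl

≃ᶜ-sym : ∀ {z w} → z ≃ᶜ w → w ≃ᶜ z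
≃ᶜ-sym (p ,ᶜ q) = ≃-sym p ,ᶜ ≃-sym q

≃ᶜ-trans : ∀ {z w v} → z ≃ᶜ w → w ≃ᶜ v → z ≃ᶜ v
≃ᶜ-trans (p ,ᶜ q) (p′ ,ᶜ q′) = ≃-trans p p′ ,ᶜ ≃-trans q q′

0ᶜ : ℂ
0ᶜ = mkℂ 0ℝ 0ℝ

-ᶜ-zero : ∀ {z w} → z ≃ᶜ w → z -ᶜ w ≃ᶜ 0ᶜ
-ᶜ-zero (p ,ᶜ q) = ≃-zero p ,ᶜ ≃-zero q

zero--ᶜ : ∀ {z w} → z -ᶜ w ≃ᶜ 0ᶜ → z ≃ᶜ w
zero--ᶜ (p ,ᶜ q) = zero-≃ p ,ᶜ zero-≃ q

normSq-cong : ∀ {z w} → z ≃ᶜ w → normSq z ≃ normSq w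
normSq-cong (p ,ᶜ q) = +-cong (*-cong p p) (*-cong q q)

normSq-* : ∀ z w → normSq (z *ᶜ w) ≃ normSq z * normSq w
normSq-* z w = ≃-pointwise λ k → solve 4 (λ a b c d →
    (a :* c :- b :* d) :* (a :* c :- b :* d) :+ (a :* d :+ b :* c) :* (a :* d :+ b :* c)
    := (a :* a :+ b :* b) :* (c :* c :+ d :* d)) refl
  (seq (re z) k) (seq (im z) k) (seq (re w) k) (seq (im w) k)

normSq-swap : ∀ z w → normSq (z -ᶜ w) ≃ normSq (w -ᶜ z)
normSq-swap z w = ≃-pointwise λ k → solve 4 (λ a b c d →
    (a :- c) :* (a :- c) :+ (b :- d) :* (b :- d) := (c :- a) :* (c :- a) :+ (d :- b) :* (d :- b)) refl
  (seq (re z) k) (seq (im z) k) (seq (re w) k) (seq (im w) k)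

*ᶜ-cong : ∀ {z z′ w w′} → z ≃ᶜ z′ → w ≃ᶜ w′ → z *ᶜ w ≃ᶜ z′ *ᶜ w′
*ᶜ-cong (p ,ᶜ q) (p′ ,ᶜ q′) =
  -‿cong (*-cong p p′) (*-cong q q′) ,ᶜ +-cong (*-cong p q′) (*-cong q p′)

*ᶜ-zeroʳ : ∀ z → z *ᶜ 0ᶜ ≃ᶜ 0ᶜ
*ᶜ-zeroʳ z =
  (≃-pointwise λ k → solve 2 (λ a b → a :* con 0ℚ :- b :* con 0ℚ := con 0ℚ) refl (seq (re z) k) (seq (im z) k))
  ,ᶜ (≃-pointwise λ k → solve 2 (λ a b → a :* con 0ℚ :+ b :* con 0ℚ := con 0ℚ) refl (seq (re z) k) (seq (im z) k))

*ᶜ-distribʳ-- : ∀ z w v → (z -ᶜ w) *ᶜ v ≃ᶜ z *ᶜ v -ᶜ w *ᶜ v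
*ᶜ-distribʳ-- z w v =
  (≃-pointwise λ k → solve 6 (λ a b c d e f →
      (a :- c) :* e :- (b :- d) :* f := (a :* e :- b :* f) :- (c :* e :- d :* f)) refl
    (seq (re z) k) (seq (im z) k) (seq (re w) k) (seq (im w) k) (seq (re v) k) (seq (im v) k))
  ,ᶜ (≃-pointwise λ k → solve 6 (λ a b c d e f →
      (a :- c) :* f :+ (b :- d) :* e := (a :* f :+ b :* e) :- (c :* f :+ d :* e)) refl
    (seq (re z) k) (seq (im z) k) (seq (re w) k) (seq (im w) k) (seq (re v) k) (seq (im v) k))

difference-identity : ∀ {p q} a b x y → p ≃ a + x → p ≃ q → q ≃ b + y → b - a ≃ x - y
difference-identity {p} {q} a b x y r s t = zero-≃ (≃-trans
  (≃-pointwise {y = (b + y) - (a + x)} λ k → solve 4 (λ a b x y → (b :- a) :- (x :- y) := (b :+ y) :- (a :+ x)) refl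
    (seq a k) (seq b k) (seq x k) (seq y k))
  (≃-zero (≃-trans (≃-sym t) (≃-trans (≃-sym s) r))))

*ᶜ-distribˡ-- : ∀ z w v → z *ᶜ w -ᶜ z *ᶜ v ≃ᶜ z *ᶜ (w -ᶜ v)
*ᶜ-distribˡ-- z w v =
  (≃-pointwise λ k → solve 6 (λ a b c d e f →
      (a :* c :- b :* d) :- (a :* e :- b :* f) := a :* (c :- e) :- b :* (d :- f)) refl
    (seq (re z) k) (seq (im z) k) (seq (re w) k) (seq (im w) k) (seq (re v) k) (seq (im v) k))
  ,ᶜ (≃-pointwise λ k → solve 6 (λ a b c d e f →
      (a :* d :+ b :* c) :- (a :* f :+ b :* e) := a :* (d :- f) :+ b :* (c :- e)) refl
    (seq (re z) k) (seq (im z) k) (seq (re w) k) (seq (im w) k) (seq (re v) k) (seq (im v) k))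

displacement : ∀ t {a c a′ c′} → a +ᶜ t *ᶜ c ≃ᶜ a′ +ᶜ t *ᶜ c′ → a′ -ᶜ a ≃ᶜ t *ᶜ (c -ᶜ c′)
displacement t {a} {c} {a′} {c′} (p ,ᶜ q) = ≃ᶜ-trans
  (difference-identity (re a) (re a′) (re (t *ᶜ c)) (re (t *ᶜ c′)) ≃-refl p ≃-refl
    ,ᶜ difference-identity (im a) (im a′) (im (t *ᶜ c)) (im (t *ᶜ c′)) ≃-refl q ≃-refl)
  (*ᶜ-distribˡ-- t c c′)

module ComplexPlane (em : ExcludedMiddle 0ℓ) where

  open RealOrder em

  normSq-zero : ∀ {z} → normSq z ≃ 0ℝ → z ≃ᶜ 0ᶜ
  normSq-zero {z} eq = square-zero (nonneg-+-zero sq₁ sq₂ eq) ,ᶜ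
    square-zero (nonneg-+-zero sq₂ sq₁ (≃-trans
      (≃-pointwise λ k → ℚₚ.+-comm (seq (im z * im z) k) (seq (re z * re z) k)) eq))
    where
    sq₁ = nonneg-square (re z)
    sq₂ = nonneg-square (im z)

  nonneg-normSq : ∀ z → Nonneg (normSq z)
  nonneg-normSq z = nonneg-+ (nonneg-square (re z)) (nonneg-square (im z))

  pos-normSq : ∀ {z} → ¬ z ≃ᶜ 0ᶜ → Pos (normSq z)
  pos-normSq {z} z≄0 = [ (λ p → p) , (λ eq → ⊥-elim (z≄0 (normSq-zero eq))) ]′ (nonneg-normSq z)

  *ᶜ-zero : ∀ {z w} → z *ᶜ w ≃ᶜ 0ᶜ → z ≃ᶜ 0ᶜ ⊎ w ≃ᶜ 0ᶜ
  *ᶜ-zero {z} {w} eq =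
    [ (λ p → inj₁ (normSq-zero p)) , (λ p → inj₂ (normSq-zero p)) ]′
    (no-zero-divisors (≃-trans (≃-sym (normSq-* z w))
      (≃-trans (normSq-cong eq) (≃-pointwise λ _ → refl))))

  SameSector : ℂ → ℂ → Set
  SameSector u v =
    (Nonneg (re u) → Nonneg (re v)) × (Nonneg (im u) → Nonneg (im v)) ×
    (Nonneg (re u * re u - im u * im u) → Nonneg (re v * re v - im v * im v)) ×
    (normSq u ≃ 0ℝ → normSq v ≃ 0ℝ)

  -- The first three bits name an octant. The last sets the zero vector apart: for it the disc
  -- inequalities can hold without forcing equal centres.
  sectorOf : ℂ → Fin 16
  sectorOf u = combine
    (combine (bit (Nonneg (re u))) (bit (Nonneg (im u))))
    (combine (bit (Nonneg (re u * re u - im u * im u))) (bit (normSq u ≃ 0ℝ)))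

  sectorOf-≡ : ∀ u v → sectorOf u ≡ sectorOf v → SameSector u v
  sectorOf-≡ u v eq =
    let p , q   = Finₚ.combine-injective (combine b₁ b₂) (combine b₃ b₄) (combine c₁ c₂) (combine c₃ c₄) eq
        p₁ , p₂ = Finₚ.combine-injective b₁ b₂ c₁ c₂ p
        p₃ , p₄ = Finₚ.combine-injective b₃ b₄ c₃ c₄ q
    in bit-≡ p₁ , bit-≡ p₂ , bit-≡ p₃ , bit-≡ p₄
    where
    b₁ = bit (Nonneg (re u))
    b₂ = bit (Nonneg (im u))
    b₃ = bit (Nonneg (re u * re u - im u * im u))
    b₄ = bit (normSq u ≃ 0ℝ)
    c₁ = bit (Nonneg (re v))
    c₂ = bit (Nonneg (im v))
    c₃ = bit (Nonneg (re v * re v - im v * im v))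
    c₄ = bit (normSq v ≃ 0ℝ)

  inner : ℂ → ℂ → ℝ
  inner u v = re u * re v + im u * im v

  -- The law of cosines at the vertex `z`; it brings the disc hypotheses into the form used by
  -- `octant`.
  inner-law : ∀ z a b → normSq (b -ᶜ a) - normSq (z -ᶜ a) ≃
    normSq (z -ᶜ b) - 2ℝ * inner (z -ᶜ a) (z -ᶜ b)
  inner-law z a b = ≃-pointwise λ k → solve 6 (λ z₁ z₂ a₁ a₂ b₁ b₂ →
      ((b₁ :- a₁) :* (b₁ :- a₁) :+ (b₂ :- a₂) :* (b₂ :- a₂))
        :- ((z₁ :- a₁) :* (z₁ :- a₁) :+ (z₂ :- a₂) :* (z₂ :- a₂))
      := ((z₁ :- b₁) :* (z₁ :- b₁) :+ (z₂ :- b₂) :* (z₂ :- b₂))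
        :- con (+ 2 ℚ./ 1) :* ((z₁ :- a₁) :* (z₁ :- b₁) :+ (z₂ :- a₂) :* (z₂ :- b₂))) refl
    (seq (re z) k) (seq (im z) k) (seq (re a) k) (seq (im a) k) (seq (re b) k) (seq (im b) k)

  inner-comm : ∀ u v → inner u v ≃ inner v u
  inner-comm u v = ≃-pointwise λ k → cong₂ ℚ._+_
    (ℚₚ.*-comm (seq (re u) k) (seq (re v) k)) (ℚₚ.*-comm (seq (im u) k) (seq (im v) k))

  -- In the triangle z, a, b the angle at z is at most 45°, so the opposite side cannot be a longest
  -- one unless z - a or z - b vanishes. The zero bit then makes both vanish.
  same-sector-separated : ∀ z a b → sectorOf (z -ᶜ a) ≡ sectorOf (z -ᶜ b) →
    Nonneg (normSq (b -ᶜ a) - normSq (z -ᶜ a)) →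
    Nonneg (normSq (a -ᶜ b) - normSq (z -ᶜ b)) → a ≃ᶜ b
  same-sector-separated z a b eq p q =
    let f₁ , f₂ , f₃ , f₄ = sectorOf-≡ u v eq
        g₁ , g₂ , g₃ , g₄ = sectorOf-≡ v u (sym eq)
        product = octant (re u) (im u) (re v) (im v)
          (same-sign f₁ g₁) (same-sign f₂ g₂) (same-sign f₃ g₃)
          (nonneg-≃ (≃-trans (inner-law z b a)
            (-‿cong {normSq u} ≃-refl (*-cong {2ℝ} ≃-refl (inner-comm v u)))) q)
          (nonneg-≃ (inner-law z a b) p)
        zeros = [ (λ U≃0 → U≃0 , f₄ U≃0) , (λ V≃0 → g₄ V≃0 , V≃0) ]′ (no-zero-divisors product)
    in ≃ᶜ-trans (≃ᶜ-sym (zero--ᶜ (normSq-zero (proj₁ zeros)))) (zero--ᶜ (normSq-zero (proj₂ zeros)))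
    where
    u = z -ᶜ a
    v = z -ᶜ b

  -- Dilates of a finite point set

  module PointSet {N : ℕ} (e : Fin N → ℂ) (e-injective : ∀ {i j} → e i ≃ᶜ e j → i ≡ j) where

    dist² : Fin N → Fin N → ℝ
    dist² a x = normSq (e x -ᶜ e a)

    Near : Fin N → Fin N → Fin N → Set
    Near a x y = Nonneg (dist² a y - dist² a x)

    near-total : ∀ a x y → Near a x y ⊎ Near a y x
    near-total a x y = [ inj₁ , (λ n → inj₂ (nonneg-≃ (swap (dist² a x) (dist² a y)) (inj₁ n))) ]′
      (sign (dist² a y - dist² a x))
      where
      swap : ∀ s t → 0ℝ - (t - s) ≃ s - t
      swap s t = ≃-pointwise λ k → solve 2 (λ s t → con 0ℚ :- (t :- s) := s :- t) refl (seq s k) (seq t k)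

    near-trans : ∀ a {x y z} → Near a x y → Near a y z → Near a x z
    near-trans a {x} {y} {z} p q =
      nonneg-≃ (telescope (dist² a x) (dist² a y) (dist² a z)) (nonneg-+ p q)
      where
      telescope : ∀ r s t → (s - r) + (t - s) ≃ t - r
      telescope r s t = ≃-pointwise λ k →
        solve 3 (λ r s t → (s :- r) :+ (t :- s) := t :- r) refl (seq r k) (seq s k) (seq t k)

    sector : Fin N → Fin N → Fin 16
    sector z a = sectorOf (e z -ᶜ e a)

    sector-separates : ∀ {z a b} → sector z a ≡ sector z b → Near a z b → Near b z a → a ≡ b
    sector-separates {z} {a} {b} eq p q = e-injective (same-sector-separated (e z) (e a) (e b) eq p q)

    open Discs em Near near-total near-trans sector sector-separates public

    module Dilate {M} (t : ℂ) (t≄0 : ¬ t ≃ᶜ 0ᶜ) (fib : Fin N → Fin N → Fin M)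
      (fib-≡ : ∀ {a c a′ c′} → fib a c ≡ fib a′ c′ → e a +ᶜ t *ᶜ e c ≃ᶜ e a′ +ᶜ t *ᶜ e c′) where

      dist²-scales : ∀ {a c a′ c′} → fib a′ c′ ≡ fib a c → dist² a a′ ≃ normSq t * dist² c c′
      dist²-scales {a} {c} {a′} {c′} eq = ≃-trans
        (normSq-cong (displacement t (fib-≡ (sym eq))))
        (≃-trans (normSq-* t (e c -ᶜ e c′)) (*-cong {normSq t} ≃-refl (normSq-swap (e c) (e c′))))

      similarity : Similarity fib
      similarity = record
        { injʳ = λ {a} {c} {c′} eq → e-injective (zero--ᶜ (
            [ (λ z → ⊥-elim (t≄0 z)) , (λ z → z) ]′
            (*ᶜ-zero (≃ᶜ-trans (≃ᶜ-sym (displacement t (fib-≡ eq))) (-ᶜ-zero (≃ᶜ-refl {e a}))))))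
        ; injˡ = λ {a} {a′} {c} eq → e-injective (≃ᶜ-sym (zero--ᶜ (≃ᶜ-trans (displacement t (fib-≡ eq))
            (≃ᶜ-trans (*ᶜ-cong (≃ᶜ-refl {t}) (-ᶜ-zero (≃ᶜ-refl {e c}))) (*ᶜ-zeroʳ t)))))
        -- Squared distances in the first coordinate are |t|² times those in the second, and |t|² >
        -- 0 cancels.
        ; near = λ {a} {c} {a′} {c′} {a″} {c″} eq eq′ p → nonneg-cancel (pos-normSq t≄0)
            (nonneg-≃ (≃-trans (-‿cong (dist²-scales eq′) (dist²-scales eq))
              (factor (normSq t) (dist² c c′) (dist² c c″))) p)
        }
        where
        factor : ∀ s x y → s * y - s * x ≃ s * (y - x)
        factor s x y = ≃-pointwise λ k →
          solve 3 (λ s x y → s :* y :- s :* x := s :* (y :- x)) refl (seq s k) (seq x k) (seq y k)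

    dilates-bound : .{{_ : ℕ.NonZero N}} → ∀ {σ M} (t : Fin σ → ℂ) →
      (∀ {i j} → t i ≃ᶜ t j → i ≡ j) → (∀ i → ¬ t i ≃ᶜ 0ᶜ) →
      (fib : Fin σ → Fin N → Fin N → Fin M) →
      (∀ i {a c a′ c′} → fib i a c ≡ fib i a′ c′ → e a +ᶜ t i *ᶜ e c ≃ᶜ e a′ +ᶜ t i *ᶜ e c′) →
      4 ℕ.* M ℕ.≤ N ℕ.* N → σ ℕ.* (N ℕ.* N) ℕ.≤ 16384 ℕ.* (M ℕ.* M)
    dilates-bound t t-inj t≄0 fib fib-≡ = family-bound fib
      (λ i → Dilate.similarity (t i) (t≄0 i) (fib i) (fib-≡ i)) determined
      where
      determined : ∀ {i j a c a′ c′} → a′ ≢ a →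
        fib i a′ c′ ≡ fib i a c → fib j a′ c′ ≡ fib j a c → i ≡ j
      -- The two expressions for a′ - a give (tᵢ - tⱼ)(c - c′) = 0, and c = c′ would force a′ = a.
      determined {i} {j} {a} {c} {a′} {c′} a′≢a eq eq′ = t-inj (zero--ᶜ (
        [ (λ z → z)
        , (λ z → ⊥-elim (a′≢a (e-injective (zero--ᶜ (≃ᶜ-trans dᵢ
            (≃ᶜ-trans (*ᶜ-cong (≃ᶜ-refl {t i}) z) (*ᶜ-zeroʳ (t i))))))))
        ]′ (*ᶜ-zero (≃ᶜ-trans (*ᶜ-distribʳ-- (t i) (t j) (e c -ᶜ e c′))
             (-ᶜ-zero (≃ᶜ-trans (≃ᶜ-sym dᵢ) dⱼ))))))
        where
        dᵢ : e a′ -ᶜ e a ≃ᶜ t i *ᶜ (e c -ᶜ e c′)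
        dᵢ = displacement (t i) (fib-≡ i (sym eq))
        dⱼ : e a′ -ᶜ e a ≃ᶜ t j *ᶜ (e c -ᶜ e c′)
        dⱼ = displacement (t j) (fib-≡ j (sym eq′))

-- The size of A + tA and of T

module Bounds (em : ExcludedMiddle 0ℓ) where

  open Classical em
  open RealOrder em

  the-spec : ∀ {P : Pred ℝ 0ℓ} → ∃ P → P (the P)
  the-spec {P} ∃P with em {∃ P}
  ... | yes (_ , p) = p
  ... | no ¬∃P      = ⊥-elim (¬∃P ∃P)

  the-cases : ∀ (P : Pred ℝ 0ℓ) → P (the P) ⊎ the P ≡ 0ℝ
  the-cases P with em {∃ P}
  ... | yes (_ , p) = inj₁ p
  ... | no _        = inj₂ refl

  ⁻¹-inverse : ∀ {x} → Pos x → x * x ⁻¹ ≃ 1ℝ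
  ⁻¹-inverse {x} p = let y , eq = inverse x p in ≃-of (the-spec {λ y → x * y ≈ 1ℝ} (y , ≈-of eq))

  1ℝ≄0ℝ : ¬ 1ℝ ≃ 0ℝ
  1ℝ≄0ℝ eq = pos-irrefl (pos-≃ eq (pos-fromℚ (ℚₚ.positive⁻¹ 1ℚ)))

  ¬nonneg-minus-pos : ∀ {x y} → x ≃ 0ℝ → Pos y → ¬ Nonneg (x - y)
  ¬nonneg-minus-pos {x} {y} z p q = pos-irrefl (pos-≃
    (≃-trans (≃-pointwise {y = x} λ k → solve 2 (λ x y → y :+ (x :- y) := x) refl (seq x k) (seq y k)) z)
    (pos-nonneg-+ p q))

  -- A value bounded below by a positive real is not the default 0, so the specification of the root
  -- holds.
  sqrt-square : ∀ {x y} → Pos y → Nonneg (√ x - y) → √ x * √ x ≃ x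
  sqrt-square {x} {y} p q =
    [ (λ h → ≃-of (proj₂ h))
    , (λ eq → ⊥-elim (¬nonneg-minus-pos (subst (_≃ 0ℝ) (sym eq) ≃-refl) p q))
    ]′ (the-cases λ s → 0ℝ ≤ s × s * s ≈ x)

  -- Since `s` is nonzero, `log x` is not the default 0; being a square it is nonnegative, as
  -- `exp-≥½` requires.
  log-≥½ : ∀ {x s} → Nonneg (x - fromℕ 3) → s * s ≃ log x → ¬ s ≃ 0ℝ → Nonneg (s * s - ½ℝ)
  log-≥½ {x} {s} x≥3 sq s≄0 =
    [ (λ isExp → large isExp)
    , (λ eq → ⊥-elim (s≄0 (square-zero (≃-trans sq (subst (_≃ 0ℝ) (sym eq) ≃-refl)))))
    ]′ (the-cases λ y → IsExp y x)
    where
    log≥0 : Nonneg (log x)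
    log≥0 = nonneg-≃ sq (nonneg-square s)
    large : IsExp (log x) x → Nonneg (s * s - ½ℝ)
    large isExp = [ (λ small → ⊥-elim (exp-≥½ log≥0 isExp x≥3 small))
                  , (λ p → nonneg-≃ (≃-trans (flip ½ℝ (log x)) (-‿cong (≃-sym sq) ≃-refl)) (inj₁ p)) ]′
                  (sign (½ℝ - log x))
      where
      flip : ∀ a b → 0ℝ - (a - b) ≃ b - a
      flip a b = ≃-pointwise λ k → solve 2 (λ a b → con 0ℚ :- (a :- b) := b :- a) refl (seq a k) (seq b k)

  -- (q w)² - m² = (q w - m)(q w - m + 2 m) ≥ 0. Multiplying by (C s)² and using C s w = 1 gives q²
  -- ≥ m² C² s², and then s² ≥ 1/2 enters.
  product-bound : ∀ C s w q m → Nonneg (q * w - m) → Nonneg m → C * s * w ≃ 1ℝ →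
    Nonneg (s * s - ½ℝ) → Nonneg (q * q - ½ℝ * (m * m * (C * C)))
  product-bound C s w q m b≥m m≥0 inv s²≥½ = nonneg-≃
    (≃-trans (identity C s w q m)
      (-‿cong (≃-trans (*-cong {q * q} ≃-refl (*-cong inv inv))
        (≃-pointwise λ k → ℚₚ.*-identityʳ (seq (q * q) k))) ≃-refl))
    (nonneg-+
      (nonneg-* (nonneg-* b≥m (nonneg-+ b≥m (nonneg-+ m≥0 m≥0))) (nonneg-square (C * s)))
      (nonneg-* (nonneg-* (nonneg-square m) (nonneg-square C)) s²≥½))
    where
    identity : ∀ C s w q m →
      (q * w - m) * ((q * w - m) + (m + m)) * (C * s * (C * s)) + m * m * (C * C) * (s * s - ½ℝ)
      ≃ q * q * (C * s * w * (C * s * w)) - ½ℝ * (m * m * (C * C))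
    identity C s w q m = ≃-pointwise λ k → solve 5 (λ C s w q m →
        (q :* w :- m) :* ((q :* w :- m) :+ (m :+ m)) :* (C :* s :* (C :* s)) :+ m :* m :* (C :* C) :* (s :* s :- con ½)
        := q :* q :* (C :* s :* w :* (C :* s :* w)) :- con ½ :* (m :* m :* (C :* C))) refl
      (seq C k) (seq s k) (seq w k) (seq q k) (seq m k)

  -- If log, √ or _⁻¹ takes its default value 0ℝ, then the upper bound on m is 0.
  sumset-bound : ∀ C x m → √ x * √ x ≃ x → Nonneg (x - fromℕ 3) → Pos m →
    m ≤ √ x ^ 3 / (C * √ (log x)) → Nonneg (x * (x * x) - ½ℝ * (m * m * (C * C)))
  sumset-bound C x m sq x≥3 m>0 m≤ = [ proper , degenerate ]′ (the-cases λ y → C * s * y ≈ 1ℝ)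
    where
    s = √ (log x)
    w = (C * s) ⁻¹
    q = √ x ^ 3
    below : Nonneg (q * w - m)
    below = ≤⇒nonneg m≤
    degenerate : w ≡ 0ℝ → Nonneg (x * (x * x) - ½ℝ * (m * m * (C * C)))
    degenerate eq = ⊥-elim (¬nonneg-minus-pos
      (zero-*ʳ q (subst (_≃ 0ℝ) (sym eq) ≃-refl)) m>0 below)
    cube : ∀ r → r ^ 3 * r ^ 3 ≃ (r * r) * ((r * r) * (r * r))
    cube r = ≃-pointwise λ k → solve 1 (λ r →
      (r :* (r :* (r :* con 1ℚ))) :* (r :* (r :* (r :* con 1ℚ))) := (r :* r) :* ((r :* r) :* (r :* r))) refl (seq r k)
    proper : C * s * w ≈ 1ℝ → Nonneg (x * (x * x) - ½ℝ * (m * m * (C * C)))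
    proper inv = nonneg-≃ (-‿cong (≃-trans (cube (√ x)) (*-cong sq (*-cong sq sq))) ≃-refl)
      (product-bound C s w q m below (inj₁ m>0) (≃-of inv) (log-≥½ x≥3 s²≃log s≄0))
      where
      s≄0 : ¬ s ≃ 0ℝ
      s≄0 z = 1ℝ≄0ℝ (≃-trans (≃-sym (≃-of inv)) (zero-*ˡ w (zero-*ʳ C z)))
      s²≃log : s * s ≃ log x
      s²≃log = [ (λ h → ≃-of (proj₂ h)) , (λ eq → ⊥-elim (s≄0 (subst (_≃ 0ℝ) (sym eq) ≃-refl))) ]′
        (the-cases λ y → 0ℝ ≤ y × y * y ≈ log x)

square-≥4 : ∀ {C} → Nonneg (C - 2ℝ) → Nonneg (C * C - fromℕ 4)
square-≥4 {C} p = nonneg-≃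
  (≃-pointwise λ k → solve 1 (λ c → (c :- con (+ 2 ℚ./ 1)) :* ((c :- con (+ 2 ℚ./ 1)) :+ con (+ 4 ℚ./ 1))
    := c :* c :- con (+ 4 ℚ./ 1)) refl (seq C k))
  (nonneg-* p (nonneg-+ p (nonneg-fromℕ 4)))

square-16 : ∀ {C r x} → Nonneg C → Nonneg (r - fromℕ 4 * C) → r * r ≃ x → Nonneg (x - fromℕ 16 * (C * C))
square-16 {C} {r} p q sq = nonneg-≃
  (≃-trans (≃-pointwise λ k → solve 2 (λ c r →
      (r :- con (+ 4 ℚ./ 1) :* c) :* ((r :- con (+ 4 ℚ./ 1) :* c) :+ con (+ 8 ℚ./ 1) :* c)
      := r :* r :- con (+ 16 ℚ./ 1) :* (c :* c)) refl (seq C k) (seq r k))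
    (-‿cong sq ≃-refl))
  (nonneg-* q (nonneg-+ q (nonneg-* (nonneg-fromℕ 8) p)))

≥64 : ∀ {x d} → Nonneg (x - fromℕ 16 * d) → Nonneg (d - fromℕ 4) → Nonneg (x - fromℕ 64)
≥64 {x} {d} p q = nonneg-≃
  (≃-pointwise λ k → solve 2 (λ x d → (x :- con (+ 16 ℚ./ 1) :* d) :+ con (+ 16 ℚ./ 1) :* (d :- con (+ 4 ℚ./ 1))
    := x :- con (+ 64 ℚ./ 1)) refl (seq x k) (seq d k))
  (nonneg-+ p (nonneg-* (nonneg-fromℕ 16) q))

-- With d = C² ≥ 4 the sumset bound weakens to the hypothesis of `quarter-square`.
cube-bound : ∀ {N M d} → Nonneg (fromℕ N * (fromℕ N * fromℕ N) - ½ℝ * (fromℕ M * fromℕ M * d)) →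
  Nonneg (d - fromℕ 4) → 2 ℕ.* (M ℕ.* M) ℕ.≤ N ℕ.* (N ℕ.* N)
cube-bound {N} {M} {d} p q = fromℕ-cancel (nonneg-≃
  (≃-trans (identity (fromℕ N * (fromℕ N * fromℕ N)) (fromℕ M * fromℕ M) d)
    (≃-sym (-‿cong
      (≃-trans (fromℕ-* N (N ℕ.* N)) (*-cong {fromℕ N} ≃-refl (fromℕ-* N N)))
      (≃-trans (fromℕ-* 2 (M ℕ.* M)) (*-cong {2ℝ} ≃-refl (fromℕ-* M M))))))
  (nonneg-+ p (nonneg-* (nonneg-* nonneg-½ (nonneg-* (nonneg-fromℕ M) (nonneg-fromℕ M))) q)))
  where
  identity : ∀ c m d → (c - ½ℝ * (m * d)) + ½ℝ * m * (d - fromℕ 4) ≃ c - 2ℝ * m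
  identity c m d = ≃-pointwise λ k → solve 3 (λ c m d →
    (c :- con ½ :* (m :* d)) :+ con ½ :* m :* (d :- con (+ 4 ℚ./ 1)) := c :- con (+ 2 ℚ./ 1) :* m) refl
    (seq c k) (seq m k) (seq d k)

K : ℝ
K = fromℕ 32769

K≃ : K ≃ 1ℝ + (fromℕ 16384 + fromℕ 16384)
K≃ = ≃-trans (fromℕ-+ 1 32768) (+-cong (≃-pointwise λ _ → refl) (fromℕ-+ 16384 16384))

-- Finiteness and cardinality of T

module Main (em : ExcludedMiddle 0ℓ) where

  open Classical em
  open RealOrder em
  open Bounds em
  open ComplexPlane em

  -- Adding d/2 times the first inequality to k times the second cancels m² and leaves x² (k x - s d
  -- / 2) ≥ 0. Doubling gives s d ≤ 2 k x, and x ≥ 16 d ≥ d pays for the extra element t = 0.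
  eliminate-sumset : ∀ {x m d k s} → Pos x → Nonneg d →
    Nonneg (k * (m * m) - s * (x * x)) →
    Nonneg (x * (x * x) - ½ℝ * (m * m * d)) → Nonneg k →
    Nonneg (x - fromℕ 16 * d) → Nonneg ((1ℝ + (k + k)) * x - (1ℝ + s) * d)
  eliminate-sumset {x} {m} {d} {k} {s} x>0 d≥0 p q k≥0 r = nonneg-≃
    (≃-pointwise λ i → solve 4 (λ x d k s →
        con (+ 2 ℚ./ 1) :* (k :* x :- con ½ :* (s :* d)) :+ ((x :- con (+ 16 ℚ./ 1) :* d) :+ con (+ 15 ℚ./ 1) :* d)
        := (con 1ℚ :+ (k :+ k)) :* x :- (con 1ℚ :+ s) :* d) refl
      (seq x i) (seq d i) (seq k i) (seq s i))
    (nonneg-+ (nonneg-* (nonneg-fromℕ 2) half) (nonneg-+ r (nonneg-* (nonneg-fromℕ 15) d≥0)))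
    where
    half : Nonneg (k * x - ½ℝ * (s * d))
    half = nonneg-cancel (pos-* x>0 x>0) (nonneg-≃
      (≃-pointwise λ i → solve 5 (λ x m d k s →
          con ½ :* d :* (k :* (m :* m) :- s :* (x :* x)) :+ k :* (x :* (x :* x) :- con ½ :* (m :* m :* d))
          := (x :* x) :* (k :* x :- con ½ :* (s :* d))) refl
        (seq x i) (seq m i) (seq d i) (seq k i) (seq s i))
      (nonneg-+ (nonneg-* (nonneg-* nonneg-½ d≥0) p) (nonneg-* k≥0 q)))

  Injectiveᶜ : ∀ {n} → (Fin n → ℂ) → Set
  Injectiveᶜ f = ∀ {i j} → f i ≃ᶜ f j → i ≡ j

  -- An injective family is extended by a missed element as long as there is one. Size plus fuel
  -- stays at least `suc L`, so running out of fuel would contradict the bound.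
  finite-card : ∀ (S : Pred ℂ 0ℓ) L →
    (∀ n (f : Fin n → ℂ) → Injectiveᶜ f → (∀ i → f i ∈ S) → n ℕ.≤ L) → ∃ (HasCard S)
  finite-card S L bound = grow (suc L) 0 (λ ()) (λ { {()} }) (λ ()) (ℕₚ.≤-reflexive (sym (ℕₚ.+-identityʳ (suc L))))
    where
    grow : ∀ fuel n (f : Fin n → ℂ) → Injectiveᶜ f → (∀ i → f i ∈ S) →
      suc L ℕ.≤ fuel ℕ.+ n → ∃ (HasCard S)
    grow zero n f inj f∈S le = ⊥-elim (ℕₚ.<-irrefl refl (ℕₚ.≤-trans le (bound n f inj f∈S)))
    grow (suc fuel) n f inj f∈S le with em {∃ λ z → z ∈ S × ¬ (∃ λ i → f i ≈ᶜ z)}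
    ... | no covered = n , f , (λ eq → inj (≈ᶜ⇒≃ᶜ eq)) , f∈S , cover
      where
      cover : ∀ z → z ∈ S → ∃[ i ] f i ≈ᶜ z
      cover z z∈S with em {∃ λ i → f i ≈ᶜ z}
      ... | yes found = found
      ... | no missed = ⊥-elim (covered (z , z∈S , missed))
    ... | yes (z , z∈S , new) = grow fuel (suc n) f⁺ inj⁺ f⁺∈S
            (ℕₚ.≤-trans le (ℕₚ.≤-reflexive (sym (ℕₚ.+-suc fuel n))))
      where
      f⁺ : Fin (suc n) → ℂ
      f⁺ zero    = z
      f⁺ (suc i) = f i
      inj⁺ : Injectiveᶜ f⁺
      inj⁺ {zero}  {zero}  _  = refl
      inj⁺ {zero}  {suc j} eq = ⊥-elim (new (j , ≃ᶜ⇒≈ᶜ (≃ᶜ-sym eq)))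
      inj⁺ {suc i} {zero}  eq = ⊥-elim (new (i , ≃ᶜ⇒≈ᶜ eq))
      inj⁺ {suc i} {suc j} eq = cong suc (inj eq)
      f⁺∈S : ∀ i → f⁺ i ∈ S
      f⁺∈S zero    = z∈S
      f⁺∈S (suc i) = f∈S i

  -- Exactly one index is removed in either case, the first one if no member is 0, so the remaining
  -- size is always `σ`.
  drop-zero : ∀ {σ} (f : Fin (suc σ) → ℂ) → Injectiveᶜ f →
    ∃[ g ] ((∀ {i j} → g i ≡ g j → i ≡ j) × (∀ (i : Fin σ) → ¬ f (g i) ≃ᶜ 0ᶜ))
  drop-zero f inj with em {∃ λ i → f i ≃ᶜ 0ᶜ}
  ... | yes (i , fi≃0) = punchIn i , (λ {j} {k} → Finₚ.punchIn-injective i j k) , λ j fj≃0 →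
          Finₚ.punchInᵢ≢i i j (inj (≃ᶜ-trans fj≃0 (≃ᶜ-sym fi≃0)))
  ... | no none = suc , Finₚ.suc-injective , λ j fj≃0 → none (suc j , fj≃0)

  module Setup {N : ℕ} {A : Pred ℂ 0ℓ} (A-card : HasCard A N) {C : ℝ}
    (C≥2 : Nonneg (C - 2ℝ)) (√N≥4C : Nonneg (√ (fromℕ N) - fromℕ 4 * C)) where

    x : ℝ
    x = fromℕ N

    C>0 : Pos C
    C>0 = pos-≃ (≃-pointwise λ k → solve 1 (λ c → con (+ 2 ℚ./ 1) :+ (c :- con (+ 2 ℚ./ 1)) := c) refl (seq C k))
      (pos-nonneg-+ (pos-fromℕ 2) C≥2)

    √-square : √ x * √ x ≃ x
    √-square = sqrt-square (pos-* (pos-fromℕ 4) C>0) √N≥4C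

    N≥16C² : Nonneg (x - fromℕ 16 * (C * C))
    N≥16C² = square-16 (inj₁ C>0) √N≥4C √-square

    N≥64 : 64 ℕ.≤ N
    N≥64 = fromℕ-cancel (≥64 N≥16C² (square-≥4 C≥2))

    instance
      N-nonZero : ℕ.NonZero N
      N-nonZero = ℕ.>-nonZero (ℕₚ.≤-trans (ℕₚ.m≤m+n 1 63) N≥64)

    e : Fin N → ℂ
    e = proj₁ A-card

    e-injective : Injectiveᶜ e
    e-injective eq = proj₁ (proj₂ A-card) (≃ᶜ⇒≈ᶜ eq)

    e∈A : ∀ i → e i ∈ A
    e∈A = proj₁ (proj₂ (proj₂ A-card))

    open PointSet e e-injective

    origin : Fin N
    origin = fromℕ< (ℕₚ.≤-trans (ℕₚ.m≤m+n 1 63) N≥64)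

    module _ (t : ℂ) {m : ℕ} (S-card : HasCard (sumDilate A t) m) where

      index : ∀ a c → ∃[ i ] proj₁ S-card i ≈ᶜ e a +ᶜ t *ᶜ e c
      index a c = proj₂ (proj₂ (proj₂ S-card)) (e a +ᶜ t *ᶜ e c)
        (e a , e c , e∈A a , e∈A c , ≃ᶜ⇒≈ᶜ (≃ᶜ-refl {e a +ᶜ t *ᶜ e c}))

      fibre : Fin N → Fin N → Fin m
      fibre a c = proj₁ (index a c)

      fibre-value : ∀ a c → proj₁ S-card (fibre a c) ≃ᶜ e a +ᶜ t *ᶜ e c
      fibre-value a c = ≈ᶜ⇒≃ᶜ (proj₂ (index a c))

      fibre-≡ : ∀ {a c a′ c′} → fibre a c ≡ fibre a′ c′ → e a +ᶜ t *ᶜ e c ≃ᶜ e a′ +ᶜ t *ᶜ e c′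
      fibre-≡ {a} {c} {a′} {c′} eq = ≃ᶜ-trans (≃ᶜ-sym (fibre-value a c))
        (subst (λ i → proj₁ S-card i ≃ᶜ e a′ +ᶜ t *ᶜ e c′) (sym eq) (fibre-value a′ c′))

    -- The first component yields the finiteness of T; the second is the sharp estimate, applied to
    -- the enumeration so obtained.
    Bounded : ℕ → Set
    Bounded n = n ℕ.≤ suc (1024 ℕ.* (N ℕ.* N)) × Nonneg (K * x - fromℕ n * (C * C))

    family-in-T : ∀ n (f : Fin n → ℂ) → Injectiveᶜ f → (∀ i → f i ∈ T A N C) → Bounded n
    -- The empty family has no largest sumset and is treated apart.
    family-in-T zero f inj f∈T = ℕ.z≤n , nonneg-≃
      (≃-pointwise λ k → solve 2 (λ a c → a := a :- con 0ℚ :* (c :* c)) refl (seq (K * x) k) (seq C k))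
      (nonneg-* (nonneg-fromℕ 32769) (nonneg-fromℕ N))
    family-in-T (suc σ) f inj f∈T = ℕ.s≤s (crude-bound {σ} {M} {N} M-small σ-bound) , nonneg-≃
      (-‿cong (*-cong (≃-sym K≃) ≃-refl)
        (*-cong (≃-sym (≃-trans (fromℕ-+ 1 σ) (+-cong (≃-pointwise λ _ → refl) ≃-refl))) ≃-refl))
      (eliminate-sumset {x} {fromℕ M} {C * C} {fromℕ 16384} {fromℕ σ} (pos-fromℕ N) (nonneg-square C)
        (nonneg-≃ (-‿cong
            (≃-trans (fromℕ-* 16384 (M ℕ.* M)) (*-cong {fromℕ 16384} ≃-refl (fromℕ-* M M)))
            (≃-trans (fromℕ-* σ (N ℕ.* N)) (*-cong {fromℕ σ} ≃-refl (fromℕ-* N N))))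
          (fromℕ-mono σ-bound))
        M-real (nonneg-fromℕ 16384) N≥16C²)
      where
      m : Fin (suc σ) → ℕ
      m i = proj₁ (f∈T i)
      S-card : ∀ i → HasCard (sumDilate A (f i)) (m i)
      S-card i = proj₁ (proj₂ (f∈T i))

      -- All fibre maps land in `Fin M` once `M` is the largest sumset size; being attained, `M`
      -- itself satisfies the bound that defines T.
      top : ∃[ b ] (_ × (∀ i → _ → m i ℕ.≤ m b))
      top = Counting.best em (λ i j → m i ℕ.≤ m j) (λ i j → ℕₚ.≤-total (m i) (m j))
        ℕₚ.≤-trans (λ i → i ≡ i) (zero , refl)
      M : ℕ
      M = m (proj₁ top)
      m≤M : ∀ i → m i ℕ.≤ M
      m≤M i = proj₂ (proj₂ top) i refl

      instance
        M-nonZero : ℕ.NonZero M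
        -- `M` ≥ 1 is what lets `sumset-bound` reject the default values.
        M-nonZero = Finₚ.nonZeroIndex (fibre (f (proj₁ top)) (S-card (proj₁ top)) origin origin)

      M-real : Nonneg (x * (x * x) - ½ℝ * (fromℕ M * fromℕ M * (C * C)))
      M-real = sumset-bound C x (fromℕ M) √-square
        (fromℕ-mono (ℕₚ.≤-trans (ℕₚ.m≤m+n 3 61) N≥64)) (pos-fromℕ M)
        (proj₂ (proj₂ (f∈T (proj₁ top))))

      M-small : 4 ℕ.* M ℕ.≤ N ℕ.* N
      M-small = quarter-square {M} {N} N≥64 (cube-bound {N} {M} M-real (square-≥4 C≥2))

      rest : ∃[ g ] ((∀ {i j} → g i ≡ g j → i ≡ j) × (∀ (i : Fin σ) → ¬ f (g i) ≃ᶜ 0ᶜ))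
      rest = drop-zero f inj
      g = proj₁ rest

      σ-bound : σ ℕ.* (N ℕ.* N) ℕ.≤ 16384 ℕ.* (M ℕ.* M)
      σ-bound = dilates-bound (λ i → f (g i)) (λ eq → proj₁ (proj₂ rest) (inj eq)) (proj₂ (proj₂ rest))
        (λ i a c → inject≤ (fibre (f (g i)) (S-card (g i)) a c) (m≤M (g i)))
        (λ i eq → fibre-≡ (f (g i)) (S-card (g i)) (Finₚ.inject≤-injective (m≤M (g i)) (m≤M (g i)) _ _ eq))
        M-small

    T-card : ∃ (HasCard (T A N C))
    T-card = finite-card (T A N C) _ λ n f inj f∈T → proj₁ (family-in-T n f inj f∈T)

    T-bound : ∀ {n} → HasCard (T A N C) n → Nonneg (K * (x / C ^ 2) - fromℕ n)
    T-bound {n} (f , inj , f∈T , _) = nonneg-≃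
      (≃-trans (factor (C * C) K x (fromℕ n) ((C ^ 2) ⁻¹))
        (-‿cong ≃-refl (≃-trans (*-cong {fromℕ n} ≃-refl inv) (≃-pointwise λ k → ℚₚ.*-identityʳ _))))
      (nonneg-* (proj₂ (family-in-T n f (λ eq → inj (≃ᶜ⇒≈ᶜ eq)) f∈T)) inv≥0)
      where
      C²>0 : Pos (C * C)
      C²>0 = pos-* C>0 C>0
      C²≃ : C * C ≃ C ^ 2
      C²≃ = *-cong {C} ≃-refl (≃-pointwise λ k → sym (ℚₚ.*-identityʳ (seq C k)))
      inv : C * C * (C ^ 2) ⁻¹ ≃ 1ℝ
      -- This reciprocal stands in the conclusion, so a default value cannot be argued away;
      -- `⁻¹-inverse` rests on the constructed `inverse`.
      inv = ≃-trans (*-cong C²≃ ≃-refl) (⁻¹-inverse (pos-≃ C²≃ C²>0))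
      inv≥0 : Nonneg ((C ^ 2) ⁻¹)
      inv≥0 = nonneg-cancel C²>0 (nonneg-≃ (≃-sym inv) (inj₁ (pos-fromℚ (ℚₚ.positive⁻¹ 1ℚ))))
      factor : ∀ d k x s z → (k * x - s * d) * z ≃ k * (x * z) - s * (d * z)
      factor d k x s z = ≃-pointwise λ i → solve 5 (λ d k x s z →
        (k :* x :- s :* d) :* z := k :* (x :* z) :- s :* (d :* z)) refl
        (seq d i) (seq k i) (seq x i) (seq s i) (seq z i)

theorem3 : (em : ExcludedMiddle 0ℓ) → let open Classical em in
    ∃[ K₁ ] ∃[ K₂ ] ∃[ K₃ ] (1ℝ < K₁ × 1ℝ < K₂ × 0ℝ < K₃ ×
    ((N : ℕ) (A : Pred ℂ 0ℓ) → HasCard A N →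
    (C : ℝ) → K₁ ≤ C → K₂ * C ≤ √ (fromℕ N) →
    CardAtMost (T A N C) (K₃ * (fromℕ N / C ^ 2))))
theorem3 em =
  2ℝ , fromℕ 4 , K ,
  pos⇒< {1ℝ} {2ℝ} (pos-≃ (≃-pointwise λ _ → refl) (pos-fromℕ 1)) ,
  pos⇒< {1ℝ} {fromℕ 4} (pos-≃ (≃-pointwise λ _ → refl) (pos-fromℕ 3)) ,
  pos⇒< {0ℝ} {K} (pos-≃ (≃-pointwise λ _ → refl) (pos-fromℕ 32769)) ,
  λ N A A-card C C≥2 √N≥4C →
    let open RealOrder em
        open Main.Setup em A-card {C} (≤⇒nonneg C≥2) (≤⇒nonneg √N≥4C)
        n , T-has-n = T-card
    in n , T-has-n , nonneg⇒≤ (T-bound T-has-n)
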